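{- Let $W\ge1$ be an integer and let $0\le\epsilon\le\frac14$. Any randomized Las Vegas algorithm that provides a $W\epsilon$-additive approximation for the Basic-Counting problem with window size $W$ requires at least $$\left\lfloor \max\left\{\log W,\ \frac{1}{2\epsilon+W^{ -1}}\right\}\right\rfloor$$ bits of memory. Further, for any fixed $\delta\in(0,1/2)$, if in addition $\epsilon\ge\frac{1}{2W}$, any Monte Carlo algorithm that with probability at least $1-\delta$ approximates Basic-Counting within $W\epsilon$ error at any time instant requires $\Omega\left(\frac1\epsilon+\log W\right)$ bits of memory.
   Context: All logarithms are base 2. Basic-Counting: given a stream of bits arriving one at a time and a window size $W$, maintain $C^W$, the number of 1's among the last $W$ bits of the stream (if fewer than $W$ bits have arrived, among all bits so far). A deterministic algorithm using $m$ bits of memory has at most $2^m$ memory configurations, a fixed initial configuration, and a deterministic transition of configuration upon each arriving bit; when queried it outputs a real number determined by its current configuration. An algorithm is $\epsilon$-correct on an input stream $S$ if at every time instant while reading $S$ its query answer differs from $C^W$ by at most $W\epsilon$. A randomized algorithm is a probability distribution over deterministic algorithms, and its memory requirement is the expected number of memory bits of the drawn deterministic algorithm (in the sense of Yao's minimax principle). A Las Vegas algorithm is a randomized algorithm that is always $\epsilon$-correct, on every input. A Monte Carlo algorithm here is a randomized algorithm that, for every input stream, is $\epsilon$-correct on it with probability at least $1-\delta$. The $\Omega(\cdot)$ is for $W\to\infty$, uniformly over the allowed $\epsilon$, with the hidden constant allowed to depend on the fixed $\delta$ only. -}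

module Defs where

open import Data.Bool.Base using (Bool)
open import Data.Fin.Base using (Fin)
open import Data.Integer.Base as ℤ using (+_)
import Data.Integer.Properties as ℤ
open import Data.List.Base using (List; _++_; length; drop; foldl; filterᵇ)
open import Data.Nat.Base as ℕ using (ℕ; zero; suc; NonZero; z≤n; s≤s; ⌊_/2⌋)
open import Data.Nat.Induction using (<-rec)
open import Data.Nat.Logarithm
import Data.Nat.Properties as ℕ
open import Data.Product.Base using (∃-syntax; _×_; _,_)
open import Data.Rational.Base as ℚ using (ℚ; mkℚ; 0ℚ; 1ℚ; ½; *<*; toℚᵘ)
import Data.Rational.Properties as ℚ
open import Data.Rational.Solver using (module +-*-Solver)
open import Data.Rational.Unnormalised.Base as ℚᵘ using (mkℚᵘ; *≤*)
import Data.Rational.Unnormalised.Properties as ℚᵘ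
open import Data.Sum.Base using (inj₁; inj₂)
open import Function.Base using (id; _∘_)
open import Function.Bundles using (_⇔_)
open import Relation.Binary.PropositionalEquality
open import Relation.Nullary using (¬_)

open +-*-Solver using (solve; _:=_; _:+_; _:*_; _:-_; :-_; con)

IsCauchy : (ℕ → ℚ) → Set
IsCauchy s = ∀ η → 0ℚ ℚ.< η → ∃[ N ] ∀ m n → N ℕ.≤ m → N ℕ.≤ n →
             ℚ.∣ s m ℚ.- s n ∣ ℚ.≤ η

record ℝ : Set where
  no-eta-equality
  constructor mkℝ
  field
    seq    : ℕ → ℚ
    cauchy : IsCauchy seq
open ℝ public

infix 4 _≤_ _<_

record _≤_ (x y : ℝ) : Set where
  constructor mk≤
  field
    eventually : ∀ η → 0ℚ ℚ.< η → ∃[ N ] ∀ n → N ℕ.≤ n → seq x n ℚ.≤ seq y n ℚ.+ η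

record _<_ (x y : ℝ) : Set where
  constructor mk<
  field
    gap        : ℚ
    0<gap      : 0ℚ ℚ.< gap
    eventually : ∃[ N ] ∀ n → N ℕ.≤ n → seq x n ℚ.+ gap ℚ.≤ seq y n

module _ where

  p≤∣p∣ : ∀ p → p ℚ.≤ ℚ.∣ p ∣
  p≤∣p∣ p with ℚ.≤-total 0ℚ p
  ... | inj₁ 0≤p = ℚ.≤-reflexive (sym (ℚ.0≤p⇒∣p∣≡p 0≤p))
  ... | inj₂ p≤0 = ℚ.≤-trans p≤0 (ℚ.0≤∣p∣ p)

  p≡q+[p-q] : ∀ p q → p ≡ q ℚ.+ (p ℚ.- q)
  p≡q+[p-q] = solve 2 (λ p q → p := q :+ (p :- q)) refl

  ∣p-q∣≤η⇒p≤q+η : ∀ {p q η} → ℚ.∣ p ℚ.- q ∣ ℚ.≤ η → p ℚ.≤ q ℚ.+ η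
  ∣p-q∣≤η⇒p≤q+η {p} {q} {η} h = begin
    p                      ≡⟨ p≡q+[p-q] p q ⟩
    q ℚ.+ (p ℚ.- q)        ≤⟨ ℚ.+-monoʳ-≤ q (p≤∣p∣ (p ℚ.- q)) ⟩
    q ℚ.+ ℚ.∣ p ℚ.- q ∣    ≤⟨ ℚ.+-monoʳ-≤ q h ⟩
    q ℚ.+ η                ∎
    where open ℚ.≤-Reasoning

  p≤q+η⇒p-q≤η : ∀ p q η → p ℚ.≤ q ℚ.+ η → p ℚ.- q ℚ.≤ η
  p≤q+η⇒p-q≤η p q η h = ℚ.≤-trans (ℚ.+-monoˡ-≤ (ℚ.- q) h)
    (ℚ.≤-reflexive (solve 2 (λ q η → q :+ η :- q := η) refl q η))

  p≤q+η∧q≤p+η⇒∣p-q∣≤η : ∀ {p q η} → p ℚ.≤ q ℚ.+ η → q ℚ.≤ p ℚ.+ η →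
                        ℚ.∣ p ℚ.- q ∣ ℚ.≤ η
  p≤q+η∧q≤p+η⇒∣p-q∣≤η {p} {q} {η} h k with ℚ.∣p∣≡p∨∣p∣≡-p (p ℚ.- q)
  ... | inj₁ e = subst (ℚ._≤ η) (sym e) (p≤q+η⇒p-q≤η p q η h)
  ... | inj₂ e = subst (ℚ._≤ η)
    (sym (trans e (solve 2 (λ p q → :- (p :- q) := q :- p) refl p q)))
    (p≤q+η⇒p-q≤η q p η k)

  0<p*q : ∀ {p q} → 0ℚ ℚ.< p → 0ℚ ℚ.< q → 0ℚ ℚ.< p ℚ.* q
  0<p*q {p} {q} 0<p 0<q = ℚ.positive⁻¹ (p ℚ.* q)
    {{ℚ.pos*pos⇒pos p {{ℚ.positive 0<p}} q {{ℚ.positive 0<q}}}}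

  0<½ : 0ℚ ℚ.< ½
  0<½ = ℚ.positive⁻¹ ½

  η≡½η+½η : ∀ η → ½ ℚ.* η ℚ.+ ½ ℚ.* η ≡ η
  η≡½η+½η = solve 1 (λ η → con ½ :* η :+ con ½ :* η := η) refl

  archimedean : ∀ η → 0ℚ ℚ.< η → ∃[ N ] ∀ n → N ℕ.≤ n → (+ 1) ℚ./ suc n ℚ.≤ η
  archimedean η@(mkℚ (+ suc p) d _) 0<η = d , λ n d≤n →
    ℚ.toℚᵘ-cancel-≤ (ℚᵘ.≤-respˡ-≃ (ℚᵘ.≃-sym (ℚ.toℚᵘ-fromℚᵘ (mkℚᵘ (+ 1) n)))
      (*≤* (ℤ.+≤+ (ℕ.≤-trans (ℕ.≤-reflexive (ℕ.*-identityˡ (suc d)))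
        (ℕ.≤-trans (s≤s d≤n) (ℕ.m≤n*m (suc n) (suc p)))))))
  archimedean (mkℚ (+ zero) d _) (*<* (ℤ.+<+ ()))
  archimedean (mkℚ (ℤ.-[1+ _ ]) d _) (*<* ())

fromℚ : ℚ → ℝ
fromℚ q .seq _ = q
fromℚ q .cauchy η 0<η = 0 , λ _ _ _ _ →
  subst (ℚ._≤ η) (sym (cong ℚ.∣_∣ (ℚ.+-inverseʳ q))) (ℚ.<⇒≤ 0<η)

fromℕ : ℕ → ℝ
fromℕ n = fromℚ (+ n ℚ./ 1)

0ℝ 1ℝ : ℝ
0ℝ = fromℚ 0ℚ
1ℝ = fromℚ 1ℚ

infix 9 _⁻¹

_⁻¹ : (n : ℕ) .{{_ : NonZero n}} → ℝ
n ⁻¹ = fromℚ (+ 1 ℚ./ n)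

infixl 7 _*_
infixl 6 _+_ _-_ _⊔_
infix  8 -_

_+_ : ℝ → ℝ → ℝ
(x + y) .seq n = seq x n ℚ.+ seq y n
(x + y) .cauchy η 0<η
  with cauchy x (½ ℚ.* η) (0<p*q 0<½ 0<η) | cauchy y (½ ℚ.* η) (0<p*q 0<½ 0<η)
... | M , f | N , g = M ℕ.⊔ N , λ m n m≥ n≥ →
  let a = seq x m ; b = seq y m ; c = seq x n ; d = seq y n in begin
  ℚ.∣ (a ℚ.+ b) ℚ.- (c ℚ.+ d) ∣
    ≡⟨ cong ℚ.∣_∣ (solve 4 (λ a b c d → a :+ b :- (c :+ d) := (a :- c) :+ (b :- d))
                     refl a b c d) ⟩
  ℚ.∣ (a ℚ.- c) ℚ.+ (b ℚ.- d) ∣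
    ≤⟨ ℚ.∣p+q∣≤∣p∣+∣q∣ (a ℚ.- c) (b ℚ.- d) ⟩
  ℚ.∣ a ℚ.- c ∣ ℚ.+ ℚ.∣ b ℚ.- d ∣
    ≤⟨ ℚ.+-mono-≤ (f m n (ℕ.m⊔n≤o⇒m≤o M N m≥) (ℕ.m⊔n≤o⇒m≤o M N n≥))
                  (g m n (ℕ.m⊔n≤o⇒n≤o M N m≥) (ℕ.m⊔n≤o⇒n≤o M N n≥)) ⟩
  ½ ℚ.* η ℚ.+ ½ ℚ.* η
    ≡⟨ η≡½η+½η η ⟩
  η ∎
  where open ℚ.≤-Reasoning

-_ : ℝ → ℝ
(- x) .seq n = ℚ.- seq x n
(- x) .cauchy η 0<η with cauchy x η 0<η
... | N , f = N , λ m n m≥ n≥ → subst (ℚ._≤ η)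
  (trans (sym (ℚ.∣-p∣≡∣p∣ (seq x m ℚ.- seq x n)))
         (cong ℚ.∣_∣ (solve 2 (λ p q → :- (p :- q) := :- p :- :- q) refl (seq x m) (seq x n))))
  (f m n m≥ n≥)

_-_ : ℝ → ℝ → ℝ
x - y = x + (- y)

_⊔_ : ℝ → ℝ → ℝ
(x ⊔ y) .seq n = seq x n ℚ.⊔ seq y n
(x ⊔ y) .cauchy η 0<η with cauchy x η 0<η | cauchy y η 0<η
... | M , f | N , g = M ℕ.⊔ N , λ m n m≥ n≥ →
  let fm = ℕ.m⊔n≤o⇒m≤o M N m≥ ; fn = ℕ.m⊔n≤o⇒m≤o M N n≥
      gm = ℕ.m⊔n≤o⇒n≤o M N m≥ ; gn = ℕ.m⊔n≤o⇒n≤o M N n≥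
  in p≤q+η∧q≤p+η⇒∣p-q∣≤η (half (seq x m) (seq y m) _ _ (f m n fm fn) (g m n gm gn))
                          (half (seq x n) (seq y n) _ _ (f n m fn fm) (g n m gn gm))
  where
  half : ∀ a b c d → ℚ.∣ a ℚ.- c ∣ ℚ.≤ η → ℚ.∣ b ℚ.- d ∣ ℚ.≤ η →
         a ℚ.⊔ b ℚ.≤ (c ℚ.⊔ d) ℚ.+ η
  half a b c d h k = ℚ.⊔-lub
    (ℚ.≤-trans (∣p-q∣≤η⇒p≤q+η {a} {c} h) (ℚ.+-monoˡ-≤ η (ℚ.p≤p⊔q c d)))
    (ℚ.≤-trans (∣p-q∣≤η⇒p≤q+η {b} {d} k) (ℚ.+-monoˡ-≤ η (ℚ.p≤q⊔p c d)))

∣_∣ : ℝ → ℝ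
∣ x ∣ .seq n = ℚ.∣ seq x n ∣
∣ x ∣ .cauchy η 0<η with cauchy x η 0<η
... | N , f = N , λ m n m≥ n≥ →
  p≤q+η∧q≤p+η⇒∣p-q∣≤η (half (seq x m) _ (f m n m≥ n≥)) (half (seq x n) _ (f n m n≥ m≥))
  where
  open ℚ.≤-Reasoning
  half : ∀ p q → ℚ.∣ p ℚ.- q ∣ ℚ.≤ η → ℚ.∣ p ∣ ℚ.≤ ℚ.∣ q ∣ ℚ.+ η
  half p q h = begin
    ℚ.∣ p ∣                     ≡⟨ cong ℚ.∣_∣ (p≡q+[p-q] p q) ⟩
    ℚ.∣ q ℚ.+ (p ℚ.- q) ∣       ≤⟨ ℚ.∣p+q∣≤∣p∣+∣q∣ q (p ℚ.- q) ⟩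
    ℚ.∣ q ∣ ℚ.+ ℚ.∣ p ℚ.- q ∣   ≤⟨ ℚ.+-monoʳ-≤ ℚ.∣ q ∣ h ⟩
    ℚ.∣ q ∣ ℚ.+ η               ∎

module _ where

  *-mono-∣∣ : ∀ p q r s → ℚ.∣ p ∣ ℚ.≤ r → ℚ.∣ q ∣ ℚ.≤ s → ℚ.∣ p ℚ.* q ∣ ℚ.≤ r ℚ.* s
  *-mono-∣∣ p q r s h k = begin
    ℚ.∣ p ℚ.* q ∣        ≡⟨ ℚ.∣p*q∣≡∣p∣*∣q∣ p q ⟩
    ℚ.∣ p ∣ ℚ.* ℚ.∣ q ∣  ≤⟨ ℚ.*-monoʳ-≤-nonNeg ℚ.∣ q ∣ {{ℚ.∣-∣-nonNeg q}} h ⟩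
    r ℚ.* ℚ.∣ q ∣        ≤⟨ ℚ.*-monoˡ-≤-nonNeg r
                             {{ℚ.nonNegative (ℚ.≤-trans (ℚ.0≤∣p∣ p) h)}} k ⟩
    r ℚ.* s              ∎
    where open ℚ.≤-Reasoning

  divide : ∀ y η → 0ℚ ℚ.< y → 0ℚ ℚ.< η → ∃[ θ ] 0ℚ ℚ.< θ × θ ℚ.* y ≡ η
  divide y η 0<y 0<η = η ℚ.* ℚ.1/ y
    , 0<p*q 0<η (ℚ.positive⁻¹ (ℚ.1/ y) {{ℚ.1/pos⇒pos y}})
    , trans (ℚ.*-assoc η (ℚ.1/ y) y)
        (trans (cong (η ℚ.*_) (ℚ.*-inverseˡ y)) (ℚ.*-identityʳ η))
    where
    instance
      posy = ℚ.positive 0<y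
      nzy = ℚ.pos⇒nonZero y

  ab-cd : ∀ a b c d → a ℚ.* b ℚ.- c ℚ.* d ≡ (a ℚ.- c) ℚ.* b ℚ.+ (b ℚ.- d) ℚ.* c
  ab-cd = solve 4 (λ a b c d → a :* b :- c :* d := (a :- c) :* b :+ (b :- d) :* c) refl

  ∣ab-cd∣≤η : ∀ a b c d θ φ B C η →
    ℚ.∣ a ℚ.- c ∣ ℚ.≤ θ → ℚ.∣ b ∣ ℚ.≤ C → ℚ.∣ b ℚ.- d ∣ ℚ.≤ φ → ℚ.∣ c ∣ ℚ.≤ B →
    θ ℚ.* C ≡ ½ ℚ.* η → φ ℚ.* B ≡ ½ ℚ.* η → ℚ.∣ a ℚ.* b ℚ.- c ℚ.* d ∣ ℚ.≤ η
  ∣ab-cd∣≤η a b c d θ φ B C η ac b≤ bd c≤ θC≡½η φB≡½η = begin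
    ℚ.∣ a ℚ.* b ℚ.- c ℚ.* d ∣
      ≡⟨ cong ℚ.∣_∣ (ab-cd a b c d) ⟩
    ℚ.∣ (a ℚ.- c) ℚ.* b ℚ.+ (b ℚ.- d) ℚ.* c ∣
      ≤⟨ ℚ.∣p+q∣≤∣p∣+∣q∣ ((a ℚ.- c) ℚ.* b) ((b ℚ.- d) ℚ.* c) ⟩
    ℚ.∣ (a ℚ.- c) ℚ.* b ∣ ℚ.+ ℚ.∣ (b ℚ.- d) ℚ.* c ∣
      ≤⟨ ℚ.+-mono-≤ {ℚ.∣ (a ℚ.- c) ℚ.* b ∣} {θ ℚ.* C} {ℚ.∣ (b ℚ.- d) ℚ.* c ∣} {φ ℚ.* B}
           (*-mono-∣∣ (a ℚ.- c) b θ C ac b≤) (*-mono-∣∣ (b ℚ.- d) c φ B bd c≤) ⟩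
    θ ℚ.* C ℚ.+ φ ℚ.* B
      ≡⟨ cong₂ ℚ._+_ θC≡½η φB≡½η ⟩
    ½ ℚ.* η ℚ.+ ½ ℚ.* η
      ≡⟨ η≡½η+½η η ⟩
    η ∎
    where open ℚ.≤-Reasoning

  0<1+∣p∣ : ∀ p → 0ℚ ℚ.< 1ℚ ℚ.+ ℚ.∣ p ∣
  0<1+∣p∣ p = ℚ.<-≤-trans (ℚ.positive⁻¹ 1ℚ)
    (ℚ.≤-trans (ℚ.≤-reflexive (sym (ℚ.+-identityʳ 1ℚ))) (ℚ.+-monoʳ-≤ 1ℚ (ℚ.0≤∣p∣ p)))

  eventually-bounded : ∀ x → ∃[ B ] 0ℚ ℚ.< B × ∃[ N ] ∀ n → N ℕ.≤ n → ℚ.∣ seq x n ∣ ℚ.≤ B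
  eventually-bounded x with cauchy x 1ℚ (ℚ.positive⁻¹ 1ℚ)
  ... | N , f = 1ℚ ℚ.+ ℚ.∣ c ∣ , 0<1+∣p∣ c , N , λ n n≥ → begin
    ℚ.∣ seq x n ∣                      ≡⟨ cong ℚ.∣_∣ (solve 2 (λ a c → a := (a :- c) :+ c)
                                            refl (seq x n) c) ⟩
    ℚ.∣ (seq x n ℚ.- c) ℚ.+ c ∣        ≤⟨ ℚ.∣p+q∣≤∣p∣+∣q∣ (seq x n ℚ.- c) c ⟩
    ℚ.∣ seq x n ℚ.- c ∣ ℚ.+ ℚ.∣ c ∣    ≤⟨ ℚ.+-monoˡ-≤ ℚ.∣ c ∣ (f n N n≥ ℕ.≤-refl) ⟩
    1ℚ ℚ.+ ℚ.∣ c ∣                     ∎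
    where
    open ℚ.≤-Reasoning
    c = seq x N

_*_ : ℝ → ℝ → ℝ
(x * y) .seq n = seq x n ℚ.* seq y n
(x * y) .cauchy η 0<η = go (eventually-bounded x) (eventually-bounded y)
  where
  finish : ∀ {θ φ B C} → θ ℚ.* C ≡ ½ ℚ.* η → φ ℚ.* B ≡ ½ ℚ.* η →
    (∃[ K ] ∀ n → K ℕ.≤ n → ℚ.∣ seq x n ∣ ℚ.≤ B) →
    (∃[ L ] ∀ n → L ℕ.≤ n → ℚ.∣ seq y n ∣ ℚ.≤ C) →
    (∃[ M ] ∀ m n → M ℕ.≤ m → M ℕ.≤ n → ℚ.∣ seq x m ℚ.- seq x n ∣ ℚ.≤ θ) →
    (∃[ N ] ∀ m n → N ℕ.≤ m → N ℕ.≤ n → ℚ.∣ seq y m ℚ.- seq y n ∣ ℚ.≤ φ) →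
    ∃[ N ] ∀ m n → N ℕ.≤ m → N ℕ.≤ n →
      ℚ.∣ seq x m ℚ.* seq y m ℚ.- seq x n ℚ.* seq y n ∣ ℚ.≤ η
  finish {θ} {φ} {B} {C} θC≡½η φB≡½η (K , bx) (L , by) (M , f) (N , g) =
    (K ℕ.⊔ L) ℕ.⊔ (M ℕ.⊔ N) , λ m n m≥ n≥ →
    let K⊔L≤m = ℕ.m⊔n≤o⇒m≤o (K ℕ.⊔ L) (M ℕ.⊔ N) m≥
        K⊔L≤n = ℕ.m⊔n≤o⇒m≤o (K ℕ.⊔ L) (M ℕ.⊔ N) n≥
        M⊔N≤m = ℕ.m⊔n≤o⇒n≤o (K ℕ.⊔ L) (M ℕ.⊔ N) m≥
        M⊔N≤n = ℕ.m⊔n≤o⇒n≤o (K ℕ.⊔ L) (M ℕ.⊔ N) n≥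
    in ∣ab-cd∣≤η (seq x m) (seq y m) (seq x n) (seq y n) θ φ B C η
         (f m n (ℕ.m⊔n≤o⇒m≤o M N M⊔N≤m) (ℕ.m⊔n≤o⇒m≤o M N M⊔N≤n))
         (by m (ℕ.m⊔n≤o⇒n≤o K L K⊔L≤m))
         (g m n (ℕ.m⊔n≤o⇒n≤o M N M⊔N≤m) (ℕ.m⊔n≤o⇒n≤o M N M⊔N≤n))
         (bx n (ℕ.m⊔n≤o⇒m≤o K L K⊔L≤n))
         θC≡½η φB≡½η

  go : (∃[ B ] 0ℚ ℚ.< B × ∃[ K ] ∀ n → K ℕ.≤ n → ℚ.∣ seq x n ∣ ℚ.≤ B) →
       (∃[ C ] 0ℚ ℚ.< C × ∃[ L ] ∀ n → L ℕ.≤ n → ℚ.∣ seq y n ∣ ℚ.≤ C) →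
       ∃[ N ] ∀ m n → N ℕ.≤ m → N ℕ.≤ n →
         ℚ.∣ seq x m ℚ.* seq y m ℚ.- seq x n ℚ.* seq y n ∣ ℚ.≤ η
  go (B , 0<B , bx) (C , 0<C , by) =
    let θ , 0<θ , θC≡½η = divide C (½ ℚ.* η) 0<C (0<p*q 0<½ 0<η)
        φ , 0<φ , φB≡½η = divide B (½ ℚ.* η) 0<B (0<p*q 0<½ 0<η)
    in finish {θ} {φ} {B} {C} θC≡½η φB≡½η bx by (cauchy x θ 0<θ) (cauchy y φ 0<φ)

module _ (d : ℚ) (0<d : 0ℚ ℚ.< d) where

  private
    instance
      posd = ℚ.positive 0<d
      nzd = ℚ.pos⇒nonZero d

  0<d⊔ : ∀ p → 0ℚ ℚ.< d ℚ.⊔ p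
  0<d⊔ p = ℚ.<-≤-trans 0<d (ℚ.p≤p⊔q d p)

  1/d⊔ : ℚ → ℚ
  1/d⊔ p = (ℚ.1/ (d ℚ.⊔ p)) {{ℚ.>-nonZero (0<d⊔ p)}}

  1/d⊔-nonNeg : ∀ p → 0ℚ ℚ.≤ 1/d⊔ p
  1/d⊔-nonNeg p = ℚ.<⇒≤ (ℚ.positive⁻¹ (1/d⊔ p)
    {{ℚ.1/pos⇒pos (d ℚ.⊔ p) {{ℚ.positive (0<d⊔ p)}}}})

  1/d⊔-inverse : ∀ p → 1/d⊔ p ℚ.* (d ℚ.⊔ p) ≡ 1ℚ
  1/d⊔-inverse p = ℚ.*-inverseˡ (d ℚ.⊔ p) {{ℚ.>-nonZero (0<d⊔ p)}}

  ∣1/d⊔∣≤1/d : ∀ p → ℚ.∣ 1/d⊔ p ∣ ℚ.≤ ℚ.1/ d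
  ∣1/d⊔∣≤1/d p = begin
    ℚ.∣ r ∣                          ≡⟨ ℚ.0≤p⇒∣p∣≡p (1/d⊔-nonNeg p) ⟩
    r                                ≡⟨ sym (ℚ.*-identityʳ r) ⟩
    r ℚ.* 1ℚ                         ≡⟨ cong (r ℚ.*_) (sym (ℚ.*-inverseʳ d)) ⟩
    r ℚ.* (d ℚ.* i)                  ≡⟨ sym (ℚ.*-assoc r d i) ⟩
    r ℚ.* d ℚ.* i                    ≤⟨ ℚ.*-monoʳ-≤-nonNeg i {{ℚ.pos⇒nonNeg i {{ℚ.1/pos⇒pos d}}}}
                                          (ℚ.*-monoˡ-≤-nonNeg r {{ℚ.nonNegative (1/d⊔-nonNeg p)}}
                                            (ℚ.p≤p⊔q d p)) ⟩
    r ℚ.* (d ℚ.⊔ p) ℚ.* i            ≡⟨ cong (ℚ._* i) (1/d⊔-inverse p) ⟩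
    1ℚ ℚ.* i                         ≡⟨ ℚ.*-identityˡ i ⟩
    i                                ∎
    where
    open ℚ.≤-Reasoning
    r = 1/d⊔ p
    i = ℚ.1/ d

  rsb-rsa : ∀ r s a b → r ℚ.* (s ℚ.* b) ℚ.- s ℚ.* (r ℚ.* a) ≡ (b ℚ.- a) ℚ.* (r ℚ.* s)
  rsb-rsa = solve 4 (λ r s a b → r :* (s :* b) :- s :* (r :* a) := (b :- a) :* (r :* s)) refl

  r-s : ∀ r s a b → r ℚ.* a ≡ 1ℚ → s ℚ.* b ≡ 1ℚ → r ℚ.- s ≡ (b ℚ.- a) ℚ.* (r ℚ.* s)
  r-s r s a b ra≡1 sb≡1 = begin
    r ℚ.- s                                  ≡⟨ cong₂ ℚ._-_ (sym (ℚ.*-identityʳ r)) (sym (ℚ.*-identityʳ s)) ⟩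
    r ℚ.* 1ℚ ℚ.- s ℚ.* 1ℚ                    ≡⟨ cong₂ (λ u v → r ℚ.* u ℚ.- s ℚ.* v) (sym sb≡1) (sym ra≡1) ⟩
    r ℚ.* (s ℚ.* b) ℚ.- s ℚ.* (r ℚ.* a)      ≡⟨ rsb-rsa r s a b ⟩
    (b ℚ.- a) ℚ.* (r ℚ.* s)                  ∎
    where open ≡-Reasoning

  ∣1/d⊔p-1/d⊔q∣≤η : ∀ θ η p q → 0ℚ ℚ.< θ → θ ℚ.* (ℚ.1/ d ℚ.* ℚ.1/ d) ≡ η →
    ℚ.∣ p ℚ.- q ∣ ℚ.≤ θ → ℚ.∣ q ℚ.- p ∣ ℚ.≤ θ → ℚ.∣ 1/d⊔ p ℚ.- 1/d⊔ q ∣ ℚ.≤ η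
  ∣1/d⊔p-1/d⊔q∣≤η θ η p q 0<θ θ/d²≡η pq qp = begin
    ℚ.∣ 1/d⊔ p ℚ.- 1/d⊔ q ∣
      ≡⟨ cong ℚ.∣_∣ (r-s (1/d⊔ p) (1/d⊔ q) (d ℚ.⊔ p) (d ℚ.⊔ q) (1/d⊔-inverse p) (1/d⊔-inverse q)) ⟩
    ℚ.∣ ((d ℚ.⊔ q) ℚ.- (d ℚ.⊔ p)) ℚ.* (1/d⊔ p ℚ.* 1/d⊔ q) ∣
      ≤⟨ *-mono-∣∣ ((d ℚ.⊔ q) ℚ.- (d ℚ.⊔ p)) (1/d⊔ p ℚ.* 1/d⊔ q) θ (ℚ.1/ d ℚ.* ℚ.1/ d)
           (p≤q+η∧q≤p+η⇒∣p-q∣≤η {d ℚ.⊔ q} {d ℚ.⊔ p} {θ} (half q p qp) (half p q pq))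
           (*-mono-∣∣ (1/d⊔ p) (1/d⊔ q) (ℚ.1/ d) (ℚ.1/ d) (∣1/d⊔∣≤1/d p) (∣1/d⊔∣≤1/d q)) ⟩
    θ ℚ.* (ℚ.1/ d ℚ.* ℚ.1/ d)
      ≡⟨ θ/d²≡η ⟩
    η ∎
    where
    open ℚ.≤-Reasoning
    half : ∀ p q → ℚ.∣ p ℚ.- q ∣ ℚ.≤ θ → d ℚ.⊔ p ℚ.≤ (d ℚ.⊔ q) ℚ.+ θ
    half p q h = ℚ.⊔-lub
      (ℚ.≤-trans (ℚ.p≤p⊔q d q) (ℚ.≤-trans (ℚ.≤-reflexive (sym (ℚ.+-identityʳ (d ℚ.⊔ q))))
        (ℚ.+-monoʳ-≤ (d ℚ.⊔ q) (ℚ.<⇒≤ 0<θ))))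
      (ℚ.≤-trans (∣p-q∣≤η⇒p≤q+η {p} {q} {θ} h) (ℚ.+-monoˡ-≤ θ (ℚ.p≤q⊔p d q)))

  1/d⊔-cauchy : ∀ x → IsCauchy (1/d⊔ ∘ seq x)
  1/d⊔-cauchy x η 0<η =
    let 0<1/d = ℚ.positive⁻¹ (ℚ.1/ d) {{ℚ.1/pos⇒pos d}}
        θ , 0<θ , θ/d²≡η = divide (ℚ.1/ d ℚ.* ℚ.1/ d) η (0<p*q 0<1/d 0<1/d) 0<η
        N , f = cauchy x θ 0<θ
    in N , λ m n m≥ n≥ → ∣1/d⊔p-1/d⊔q∣≤η θ η (seq x m) (seq x n) 0<θ θ/d²≡η
             (f m n m≥ n≥) (f n m n≥ m≥)

-- The reciprocal of x.  The proof of 0 < x supplies a rational d > 0 with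
-- d ≤ seq x n for all large n; for those n the nth term is 1 / seq x n.
recip : (x : ℝ) → 0ℝ < x → ℝ
recip x (mk< d 0<d _) = mkℝ (1/d⊔ d 0<d ∘ seq x) (1/d⊔-cauchy d 0<d x)

module _ where

  2^⌊log₂n⌋≤n : ∀ n .{{_ : NonZero n}} → 2 ℕ.^ ⌊log₂ n ⌋ ℕ.≤ n
  2^⌊log₂n⌋≤n n {{nz}} = <-rec (λ n → .(NonZero n) → 2 ℕ.^ ⌊log₂ n ⌋ ℕ.≤ n) step n nz
    where
    step : ∀ n → (∀ {m} → m ℕ.< n → .(NonZero m) → 2 ℕ.^ ⌊log₂ m ⌋ ℕ.≤ m) →
           .(NonZero n) → 2 ℕ.^ ⌊log₂ n ⌋ ℕ.≤ n
    step (suc zero)      rec _ = ℕ.≤-refl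
    step n@(suc (suc k)) rec _ = begin
      2 ℕ.^ ⌊log₂ n ⌋                      ≤⟨ ℕ.^-monoʳ-≤ 2 (ℕ.m≤n+m∸n ⌊log₂ n ⌋ 1) ⟩
      2 ℕ.^ suc (⌊log₂ n ⌋ ℕ.∸ 1)          ≡⟨ cong (λ e → 2 ℕ.^ suc e) (sym (⌊log₂⌊n/2⌋⌋≡⌊log₂n⌋∸1 n)) ⟩
      2 ℕ.* 2 ℕ.^ ⌊log₂ h ⌋                ≤⟨ ℕ.*-monoʳ-≤ 2 (rec (ℕ.⌊n/2⌋<n (suc k)) _) ⟩
      2 ℕ.* h                              ≡⟨ cong (h ℕ.+_) (ℕ.+-identityʳ h) ⟩
      h ℕ.+ h                              ≤⟨ ℕ.+-monoʳ-≤ h (ℕ.⌊n/2⌋≤⌈n/2⌉ n) ⟩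
      h ℕ.+ ℕ.⌈ n /2⌉                      ≡⟨ ℕ.⌊n/2⌋+⌈n/2⌉≡n n ⟩
      n                                    ∎
      where
      open ℕ.≤-Reasoning
      h = ⌊ n /2⌋

  n<2^[1+⌊log₂n⌋] : ∀ n → n ℕ.< 2 ℕ.^ suc ⌊log₂ n ⌋
  n<2^[1+⌊log₂n⌋] n = ℕ.≰⇒> λ h → ℕ.<-irrefl refl
    (subst (ℕ._≤ ⌊log₂ n ⌋) (⌊log₂[2^n]⌋≡n (suc ⌊log₂ n ⌋)) (⌊log₂⌋-mono-≤ h))

  ⌊log₂W^i⌋j≤[1+⌊log₂W^j⌋]i : ∀ W .{{_ : NonZero W}} i j .{{_ : NonZero i}} →
    ⌊log₂ W ℕ.^ i ⌋ ℕ.* j ℕ.≤ suc ⌊log₂ W ℕ.^ j ⌋ ℕ.* i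
  ⌊log₂W^i⌋j≤[1+⌊log₂W^j⌋]i W i j = ℕ.≮⇒≥ λ h → ℕ.<-irrefl refl (begin-strict
    W ℕ.^ (i ℕ.* j)                              ≡⟨ cong (W ℕ.^_) (ℕ.*-comm i j) ⟩
    W ℕ.^ (j ℕ.* i)                              ≡⟨ sym (ℕ.^-*-assoc W j i) ⟩
    (W ℕ.^ j) ℕ.^ i                              <⟨ ℕ.^-monoˡ-< i (n<2^[1+⌊log₂n⌋] (W ℕ.^ j)) ⟩
    (2 ℕ.^ suc ⌊log₂ W ℕ.^ j ⌋) ℕ.^ i            ≡⟨ ℕ.^-*-assoc 2 (suc ⌊log₂ W ℕ.^ j ⌋) i ⟩
    2 ℕ.^ (suc ⌊log₂ W ℕ.^ j ⌋ ℕ.* i)            ≤⟨ ℕ.^-monoʳ-≤ 2 (ℕ.<⇒≤ h) ⟩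
    2 ℕ.^ (⌊log₂ W ℕ.^ i ⌋ ℕ.* j)                ≡⟨ sym (ℕ.^-*-assoc 2 ⌊log₂ W ℕ.^ i ⌋ j) ⟩
    (2 ℕ.^ ⌊log₂ W ℕ.^ i ⌋) ℕ.^ j                ≤⟨ ℕ.^-monoˡ-≤ j (2^⌊log₂n⌋≤n (W ℕ.^ i) {{ℕ.m^n≢0 W i}}) ⟩
    (W ℕ.^ i) ℕ.^ j                              ≡⟨ ℕ.^-*-assoc W i j ⟩
    W ℕ.^ (i ℕ.* j)                              ∎)
    where open ℕ.≤-Reasoning

  a/i≤b/j+1/j : ∀ a b i j → a ℕ.* suc j ℕ.≤ suc b ℕ.* suc i →
                + a ℚ./ suc i ℚ.≤ + b ℚ./ suc j ℚ.+ + 1 ℚ./ suc j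
  a/i≤b/j+1/j a b i j h = ℚ.toℚᵘ-cancel-≤ (begin
    toℚᵘ (+ a ℚ./ suc i)                          ≃⟨ ℚ.toℚᵘ-fromℚᵘ (mkℚᵘ (+ a) i) ⟩
    mkℚᵘ (+ a) i                                  ≤⟨ *≤* (subst₂ ℤ._≤_ (ℤ.pos-* a (suc j)) (ℤ.pos-* (suc b) (suc i)) (ℤ.+≤+ h)) ⟩
    mkℚᵘ (+ suc b) j                              ≃⟨ ℚᵘ.*≡* eq ⟩
    mkℚᵘ (+ b) j ℚᵘ.+ mkℚᵘ (+ 1) j                ≃⟨ ℚᵘ.+-cong (ℚᵘ.≃-sym (ℚ.toℚᵘ-fromℚᵘ (mkℚᵘ (+ b) j)))
                                                              (ℚᵘ.≃-sym (ℚ.toℚᵘ-fromℚᵘ (mkℚᵘ (+ 1) j))) ⟩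
    toℚᵘ (+ b ℚ./ suc j) ℚᵘ.+ toℚᵘ (+ 1 ℚ./ suc j) ≃⟨ ℚᵘ.≃-sym (ℚ.toℚᵘ-homo-+ (+ b ℚ./ suc j) (+ 1 ℚ./ suc j)) ⟩
    toℚᵘ (+ b ℚ./ suc j ℚ.+ + 1 ℚ./ suc j)        ∎)
    where
    open ℚᵘ.≤-Reasoning
    j′ = + suc j
    eq : + suc b ℤ.* (j′ ℤ.* j′) ≡ (+ b ℤ.* j′ ℤ.+ + 1 ℤ.* j′) ℤ.* j′
    eq = trans (sym (ℤ.*-assoc (+ suc b) j′ j′)) (cong (ℤ._* j′)
      (trans (cong (λ t → + t ℤ.* j′) (ℕ.+-comm 1 b)) (ℤ.*-distribʳ-+ j′ (+ b) (+ 1))))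

-- ⌊log₂ W^k⌋ / k tends to log₂ W, being within 1/k of it.
log₂ : (W : ℕ) .{{_ : NonZero W}} → ℝ
log₂ W .seq n = + ⌊log₂ W ℕ.^ suc n ⌋ ℚ./ suc n
log₂ W .cauchy η 0<η with archimedean η 0<η
... | N , f = N , λ m n m≥ n≥ → p≤q+η∧q≤p+η⇒∣p-q∣≤η (half m n n≥) (half n m m≥)
  where
  half : ∀ m n → N ℕ.≤ n → seq (log₂ W) m ℚ.≤ seq (log₂ W) n ℚ.+ η
  half m n n≥ = ℚ.≤-trans
    (a/i≤b/j+1/j ⌊log₂ W ℕ.^ suc m ⌋ ⌊log₂ W ℕ.^ suc n ⌋ m n
      (⌊log₂W^i⌋j≤[1+⌊log₂W^j⌋]i W (suc m) (suc n)))
    (ℚ.+-monoʳ-≤ (seq (log₂ W) n) (f n n≥))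

-- k = ⌊x⌋, for x ≥ 0.  The floor is not computable as a function on ℝ.
IsFloor : ℝ → ℕ → Set
IsFloor x k = fromℕ k ≤ x × x < fromℕ (suc k)

-- x ≤ sup s, where the supremum is allowed to be infinite
infix 4 _≤sup_

_≤sup_ : ℝ → (ℕ → ℝ) → Set
x ≤sup s = ∀ b → (∀ n → s n ≤ b) → x ≤ b

IsSup : (ℕ → ℝ) → ℝ → Set
IsSup s x = (∀ n → s n ≤ x) × x ≤sup s

partialSums : (ℕ → ℝ) → ℕ → ℝ
partialSums f zero    = 0ℝ
partialSums f (suc n) = partialSums f n + f n

-- Events need only form an algebra, and P is countably additive on it; every
-- probability space is of this form.  The sum of a series of nonnegative terms
-- is expressed as the supremum of its partial sums.
record ProbabilitySpace : Set₁ where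
  infix 4 _∈_
  field
    Ω     : Set
    Event : Set
    _∈_   : Ω → Event → Set
    full  : Event
    _∩_   : Event → Event → Event
    ∁     : Event → Event
    ∈full : ∀ ω → ω ∈ full
    ∈∩    : ∀ E F ω → ω ∈ (E ∩ F) ⇔ (ω ∈ E × ω ∈ F)
    ∈∁    : ∀ E ω → ω ∈ ∁ E ⇔ (¬ ω ∈ E)

  -- The double negation makes this the union in the classical sense.
  IsDisjointUnion : (ℕ → Event) → Event → Set
  IsDisjointUnion E U =
      (∀ i j → i ≢ j → ∀ ω → ¬ (ω ∈ E i × ω ∈ E j))
    × (∀ i ω → ω ∈ E i → ω ∈ U)
    × (∀ ω → ω ∈ U → ¬ ¬ (∃[ i ] ω ∈ E i))

  field
    P      : Event → ℝ
    P-pos  : ∀ E → 0ℝ ≤ P E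
    P-full : P full ≤ 1ℝ × 1ℝ ≤ P full
    P-∪    : ∀ E U → IsDisjointUnion E U → IsSup (partialSums (P ∘ E)) (P U)

-- A stream read so far lists its bits in order of arrival.
Stream : Set
Stream = List Bool

windowCount : ℕ → Stream → ℕ
windowCount W S = length (filterᵇ id (drop (length S ℕ.∸ W) S))

record Algorithm : Set where
  field
    bits    : ℕ
    configs : ℕ
    fits    : configs ℕ.≤ 2 ℕ.^ bits
    initial : Fin configs
    step    : Fin configs → Bool → Fin configs
    answer  : Fin configs → ℝ

  answerAfter : Stream → ℝ
  answerAfter S = answer (foldl step initial S)
open Algorithm public using (bits; answerAfter)

-- R is the part of S read so far.
CorrectOn : ℕ → ℝ → Algorithm → Stream → Set
CorrectOn W ε A S = ∀ R T → R ++ T ≡ S →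
  ∣ answerAfter A R - fromℕ (windowCount W R) ∣ ≤ fromℕ W * ε

-- A distribution over deterministic algorithms, given as a random variable
-- whose memory size is measurable.
record RandomizedAlgorithm : Set₁ where
  field
    space     : ProbabilitySpace
  open ProbabilitySpace space public
  field
    draw      : Ω → Algorithm
    bits≡     : ℕ → Event
    ∈bits≡    : ∀ k ω → ω ∈ bits≡ k ⇔ bits (draw ω) ≡ k

-- The expected number of memory bits, Σ k · P(bits = k), is at least x.
-- This sum may be infinite.
infix 4 _≤𝔼bits_

_≤𝔼bits_ : ℝ → RandomizedAlgorithm → Set
x ≤𝔼bits A = x ≤sup partialSums (λ k → fromℕ k * P (bits≡ k))
  where open RandomizedAlgorithm A

LasVegas : ℕ → ℝ → RandomizedAlgorithm → Set
LasVegas W ε A = ∀ ω S → CorrectOn W ε (draw ω) S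
  where open RandomizedAlgorithm A

-- When correctness on S is itself an event, E can be taken to be that event.
MonteCarlo : ℕ → ℝ → ℝ → RandomizedAlgorithm → Set
MonteCarlo W ε δ A = ∀ S →
  ∃[ E ] (∀ ω → ω ∈ E → CorrectOn W ε (draw ω) S) × 1ℝ - δ ≤ P E
  where open RandomizedAlgorithm A

module _ where

  <-≤-trans : ∀ {x y z} → x < y → y ≤ z → x < z
  <-≤-trans {x} {y} {z} (mk< d 0<d (M , f)) (mk≤ y≤z) with y≤z (½ ℚ.* d) (0<p*q 0<½ 0<d)
  ... | N , g = mk< (½ ℚ.* d) (0<p*q 0<½ 0<d) (M ℕ.⊔ N , λ n n≥ →
    shift (seq x n) (seq y n) (seq z n) (f n (ℕ.m⊔n≤o⇒m≤o M N n≥)) (g n (ℕ.m⊔n≤o⇒n≤o M N n≥)))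
    where
    e = ½ ℚ.* d
    a+½d : ∀ a d → a ℚ.+ ½ ℚ.* d ≡ a ℚ.+ d ℚ.- ½ ℚ.* d
    a+½d = solve 2 (λ a d → a :+ con ½ :* d := a :+ d :- con ½ :* d) refl
    c+e-e : ∀ c e → c ℚ.+ e ℚ.- e ≡ c
    c+e-e = solve 2 (λ c e → c :+ e :- e := c) refl
    shift : ∀ a b c → a ℚ.+ d ℚ.≤ b → b ℚ.≤ c ℚ.+ e → a ℚ.+ e ℚ.≤ c
    shift a b c h k = begin
      a ℚ.+ e               ≡⟨ a+½d a d ⟩
      a ℚ.+ d ℚ.- e         ≤⟨ ℚ.+-monoˡ-≤ (ℚ.- e) {a ℚ.+ d} {b} h ⟩
      b ℚ.- e               ≤⟨ ℚ.+-monoˡ-≤ (ℚ.- e) {b} {c ℚ.+ e} k ⟩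
      c ℚ.+ e ℚ.- e         ≡⟨ c+e-e c e ⟩
      c                     ∎
      where open ℚ.≤-Reasoning

  0<1/n : ∀ n .{{_ : NonZero n}} → 0ℚ ℚ.< + 1 ℚ./ n
  0<1/n n = ℚ.positive⁻¹ (+ 1 ℚ./ n) {{ℚ.normalize-pos 1 n}}

0<2⁻¹*W⁻¹ : ∀ W .{{_ : NonZero W}} → 0ℝ < 2 ⁻¹ * W ⁻¹
0<2⁻¹*W⁻¹ W = mk< (½ ℚ.* i) (0<p*q 0<½ (0<1/n W)) (0 , λ _ _ →
  ℚ.≤-reflexive (ℚ.+-identityˡ (½ ℚ.* i)))
  where i = + 1 ℚ./ W

0<2ε+W⁻¹ : ∀ W .{{_ : NonZero W}} {ε} → 0ℝ ≤ ε → 0ℝ < fromℕ 2 * ε + W ⁻¹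
0<2ε+W⁻¹ W {ε} (mk≤ 0≤ε) =
  let N , f = 0≤ε (½ ℚ.* (½ ℚ.* i)) (0<p*q 0<½ (0<p*q 0<½ (0<1/n W)))
  in mk< (½ ℚ.* i) (0<p*q 0<½ (0<1/n W)) (N , λ n n≥ → half (seq ε n) (f n n≥))
  where
  i = + 1 ℚ./ W
  two = + 2 ℚ./ 1
  2[e+i/4]+i/2 : ∀ e i → two ℚ.* (e ℚ.+ ½ ℚ.* (½ ℚ.* i)) ℚ.+ ½ ℚ.* i ≡ two ℚ.* e ℚ.+ i
  2[e+i/4]+i/2 = solve 2 (λ e i → con two :* (e :+ con ½ :* (con ½ :* i)) :+ con ½ :* i
                                    := con two :* e :+ i) refl
  half : ∀ e → 0ℚ ℚ.≤ e ℚ.+ ½ ℚ.* (½ ℚ.* i) → 0ℚ ℚ.+ ½ ℚ.* i ℚ.≤ two ℚ.* e ℚ.+ i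
  half e h = begin
    0ℚ ℚ.+ ½ ℚ.* i                                ≡⟨ cong (ℚ._+ ½ ℚ.* i) (sym (ℚ.*-zeroʳ two)) ⟩
    two ℚ.* 0ℚ ℚ.+ ½ ℚ.* i                        ≤⟨ ℚ.+-monoˡ-≤ (½ ℚ.* i)
                                                       {two ℚ.* 0ℚ} {two ℚ.* (e ℚ.+ ½ ℚ.* (½ ℚ.* i))}
                                                       (ℚ.*-monoˡ-≤-nonNeg two h) ⟩
    two ℚ.* (e ℚ.+ ½ ℚ.* (½ ℚ.* i)) ℚ.+ ½ ℚ.* i   ≡⟨ 2[e+i/4]+i/2 e i ⟩
    two ℚ.* e ℚ.+ i                               ∎
    where open ℚ.≤-Reasoning

{-# OPTIONS --safe #-}
module Submission where

-- Both bounds come from two facts about a deterministic algorithm, each of which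
-- needs correctness on particular streams only.  They rest on the remark that if two
-- moments share a configuration they share an answer, so their window counts
-- differ by at most 2Wε (same-config⇒close).
--
-- W<2^[1+bits]: suppose the algorithm is correct on W ones followed by many zeros.
-- If 2 · configs ≤ W, two of the first moments t ≤ configs of the run of zeros share a
-- configuration, hence the run is periodic from there on.  The configuration at
-- some t < configs, with more than W/2 ones in the window, then recurs when the window
-- is empty, although 2Wε ≤ W/2.
--
-- correct-words≤2^bits: let mB ≤ W and 2Wε < B, and turn a word of m bits into a
-- stream of m constant blocks of length B followed by W zeros.  Two words whose
-- streams are answered correctly reach distinct configurations after their blocks:
-- otherwise zeros can be appended until the window begins with the last differing
-- blocks, where the counts differ by exactly B.  So at most 2^bits words can be
-- answered correctly.
--
-- For a Las Vegas algorithm every draw satisfies both facts.  If k ≤ max(log W, y),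
-- where y = 1 / (2ε + 1/W), and a draw has fewer than k bits, the first fact gives
-- W < 2^k and so log W < k ≤ y.  Then B = ⌊W/k⌋ exceeds 2Wε and the second fact,
-- applied to all 2^k words, gives k ≤ bits.  Markov's inequality turns this into
-- a bound on the expectation.
--
-- For a Monte Carlo algorithm the first fact gives P(bits ≥ ⌊log W⌋) ≥ 1 - δ.  For
-- the second, let the word be uniform among the 2^m.  A draw with fewer than m bits is
-- correct on at most half of the words, while each word is answered correctly
-- with probability at least 1 - δ; double counting (ΣP≤M*P[F]) yields
-- P(bits < m) ≤ 2δ.  With ⌊W/B⌋ blocks, B being the least integer above 2Wε,
-- Markov's inequality bounds the expectation by multiples of 1/ε and of log W.
--
-- The order of the reals is stable under double negation (≮⇒≥), so the conclusion
-- may be proved by contradiction, which provides the integer B.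

open import Defs
open import Data.Bool.Base using (Bool; true; false; not)
open import Data.Bool.Properties using (¬-not) renaming (_≟_ to _≟ᵇ_)
open import Data.Empty using (⊥)
open import Data.Fin.Base as Fin using (Fin; toℕ)
open import Data.Fin.Properties using (pigeonhole; toℕ<n)
open import Data.Integer.Base as ℤ using (+_)
import Data.Integer.Properties as ℤ
open import Data.List.Base using (List; []; _∷_; _++_; length; foldl; foldr; map; replicate; drop; filterᵇ; lookup)
open import Data.List.Membership.Propositional.Properties using (∈-lookup)
open import Data.List.Properties using (length-++; length-map; length-replicate; foldl-++; ++-assoc; ++-identityʳ)
open import Data.List.Relation.Binary.Sublist.Propositional using (_⊆_; []; _∷_; _∷ʳ_; minimum)
open import Data.List.Relation.Binary.Sublist.Propositional.Properties using (All-resp-⊆)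
open import Data.List.Relation.Unary.All as All using (All; []; _∷_)
import Data.List.Relation.Unary.All.Properties as All
open import Data.List.Relation.Unary.AllPairs using ([]; _∷_)
import Data.List.Relation.Unary.AllPairs.Properties as AllPairs
open import Data.List.Relation.Unary.Unique.Propositional using (Unique)
import Data.List.Relation.Unary.Unique.Propositional.Properties as Unique
open import Data.Nat.Base as ℕ using (ℕ; zero; suc; NonZero; z≤n; s≤s)
open import Data.Nat.DivMod using (m/n*n≤m; m≡m%n+[m/n]*n; m%n<n; m≥n⇒m/n>0)
open import Data.Nat.Logarithm using (⌊log₂_⌋; ⌊log₂⌋-mono-≤; ⌊log₂[2^n]⌋≡n)
import Data.Nat.Properties as ℕ
open import Data.Nat.Tactic.RingSolver using (solve-∀)
open import Data.Product.Base using (∃-syntax; _×_; _,_; proj₁; proj₂)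
open import Data.Rational.Base as ℚ using (ℚ; 0ℚ; 1ℚ; ½; toℚᵘ)
import Data.Rational.Properties as ℚ
open import Data.Rational.Solver using (module +-*-Solver)
open import Data.Rational.Unnormalised.Base as ℚᵘ using (mkℚᵘ; *≡*; *≤*)
import Data.Rational.Unnormalised.Properties as ℚᵘ
open import Data.Sum.Base using (inj₁; inj₂)
open import Data.Vec.Base using (Vec; []; _∷_)
open import Data.Vec.Properties using (∷-injectiveˡ; ∷-injectiveʳ)
open import Function.Base using (id; _∘_)
open import Function.Bundles using (module Equivalence)
open import Relation.Binary.Bundles using (Preorder)
open import Relation.Binary.PropositionalEquality
open import Relation.Nullary using (¬_; yes; no; contradiction)

open +-*-Solver using (solve; _:=_; _:+_; _:*_; _:-_; :-_; con)
open Equivalence using (to; from)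

-- The order of the reals

infix 4 _≈_

-- Termwise equality of the representing sequences, which is finer than equality of reals.
_≈_ : ℝ → ℝ → Set
x ≈ y = ∀ n → seq x n ≡ seq y n

p≤p+η : ∀ p {η} → 0ℚ ℚ.≤ η → p ℚ.≤ p ℚ.+ η
p≤p+η p {η} 0≤η = subst (ℚ._≤ p ℚ.+ η) (ℚ.+-identityʳ p) (ℚ.+-monoʳ-≤ p {0ℚ} {η} 0≤η)

pointwise : ∀ {x y} → (∀ n → seq x n ℚ.≤ seq y n) → x ≤ y
pointwise {_} {y} h = mk≤ λ η 0<η → 0 , λ n _ →
  ℚ.≤-trans (h n) (p≤p+η (seq y n) (ℚ.<⇒≤ 0<η))

≈⇒≤ : ∀ {x y} → x ≈ y → x ≤ y
≈⇒≤ h = pointwise (ℚ.≤-reflexive ∘ h)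

≤-refl : ∀ {x} → x ≤ x
≤-refl = pointwise (λ _ → ℚ.≤-refl)

0<½η : ∀ {η} → 0ℚ ℚ.< η → 0ℚ ℚ.< ½ ℚ.* η
0<½η = 0<p*q 0<½

≤-trans : ∀ {x y z} → x ≤ y → y ≤ z → x ≤ z
≤-trans {x} {y} {z} (mk≤ f) (mk≤ g) = mk≤ λ η 0<η →
  let M , h = f (½ ℚ.* η) (0<½η 0<η)
      N , k = g (½ ℚ.* η) (0<½η 0<η)
  in M ℕ.⊔ N , λ n n≥ → begin
    seq x n                               ≤⟨ h n (ℕ.m⊔n≤o⇒m≤o M N n≥) ⟩
    seq y n ℚ.+ ½ ℚ.* η                   ≤⟨ ℚ.+-monoˡ-≤ (½ ℚ.* η) (k n (ℕ.m⊔n≤o⇒n≤o M N n≥)) ⟩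
    seq z n ℚ.+ ½ ℚ.* η ℚ.+ ½ ℚ.* η       ≡⟨ ℚ.+-assoc (seq z n) (½ ℚ.* η) (½ ℚ.* η) ⟩
    seq z n ℚ.+ (½ ℚ.* η ℚ.+ ½ ℚ.* η)     ≡⟨ cong (seq z n ℚ.+_) (η≡½η+½η η) ⟩
    seq z n ℚ.+ η                         ∎
  where open ℚ.≤-Reasoning

≤-preorder : Preorder _ _ _
≤-preorder = record
  { Carrier    = ℝ
  ; _≈_        = _≈_
  ; _≲_        = _≤_
  ; isPreorder = record
    { isEquivalence = record
      { refl  = λ _ → refl
      ; sym   = λ h → sym ∘ h
      ; trans = λ h k n → trans (h n) (k n)
      }
    ; reflexive = ≈⇒≤
    ; trans     = ≤-trans
    }
  }

module ≤-Reasoning where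
  open import Relation.Binary.Reasoning.Preorder ≤-preorder public

+-mono-≤ : ∀ {x y u v} → x ≤ y → u ≤ v → x + u ≤ y + v
+-mono-≤ {x} {y} {u} {v} (mk≤ f) (mk≤ g) = mk≤ λ η 0<η →
  let M , h = f (½ ℚ.* η) (0<½η 0<η)
      N , k = g (½ ℚ.* η) (0<½η 0<η)
  in M ℕ.⊔ N , λ n n≥ → begin
    seq x n ℚ.+ seq u n
      ≤⟨ ℚ.+-mono-≤ (h n (ℕ.m⊔n≤o⇒m≤o M N n≥)) (k n (ℕ.m⊔n≤o⇒n≤o M N n≥)) ⟩
    (seq y n ℚ.+ ½ ℚ.* η) ℚ.+ (seq v n ℚ.+ ½ ℚ.* η)
      ≡⟨ solve 3 (λ y v η → (y :+ con ½ :* η) :+ (v :+ con ½ :* η) := y :+ v :+ η)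
           refl (seq y n) (seq v n) η ⟩
    seq y n ℚ.+ seq v n ℚ.+ η ∎
  where open ℚ.≤-Reasoning

+-monoʳ-≤ : ∀ x {u v} → u ≤ v → x + u ≤ x + v
+-monoʳ-≤ x = +-mono-≤ (≤-refl {x})

+-monoˡ-≤ : ∀ x {u v} → u ≤ v → u + x ≤ v + x
+-monoˡ-≤ x h = +-mono-≤ h (≤-refl {x})

+-cancelʳ-≤ : ∀ {x y} z → x + z ≤ y + z → x ≤ y
+-cancelʳ-≤ {x} {y} z h = begin
  x             ≈⟨ (λ n → sym (a+b-b (seq x n) (seq z n))) ⟩
  x + z - z     ≲⟨ +-monoˡ-≤ (- z) h ⟩
  y + z - z     ≈⟨ (λ n → a+b-b (seq y n) (seq z n)) ⟩
  y             ∎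
  where
  open ≤-Reasoning
  a+b-b : ∀ a b → a ℚ.+ b ℚ.- b ≡ a
  a+b-b = solve 2 (λ a b → a :+ b :- b := a) refl

*-monoˡ-≤ : ∀ {q x y} → 0ℚ ℚ.≤ q → x ≤ y → fromℚ q * x ≤ fromℚ q * y
*-monoˡ-≤ {q} {x} {y} 0≤q (mk≤ f) = mk≤ λ η 0<η →
  let θ , 0<θ , θ[1+q]≡η = divide (1ℚ ℚ.+ q) η 0<1+q 0<η
      N , h = f θ 0<θ
  in N , λ n n≥ → begin
    q ℚ.* seq x n                        ≤⟨ ℚ.*-monoˡ-≤-nonNeg q (h n n≥) ⟩
    q ℚ.* (seq y n ℚ.+ θ)                ≤⟨ p≤p+η (q ℚ.* (seq y n ℚ.+ θ)) (ℚ.<⇒≤ 0<θ) ⟩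
    q ℚ.* (seq y n ℚ.+ θ) ℚ.+ θ          ≡⟨ solve 3 (λ q y θ → q :* (y :+ θ) :+ θ := q :* y :+ θ :* (con 1ℚ :+ q))
                                              refl q (seq y n) θ ⟩
    q ℚ.* seq y n ℚ.+ θ ℚ.* (1ℚ ℚ.+ q)   ≡⟨ cong (q ℚ.* seq y n ℚ.+_) θ[1+q]≡η ⟩
    q ℚ.* seq y n ℚ.+ η                  ∎
  where
  open ℚ.≤-Reasoning
  instance
    nonNegq = ℚ.nonNegative 0≤q
  0<1+q : 0ℚ ℚ.< 1ℚ ℚ.+ q
  0<1+q = ℚ.<-≤-trans (ℚ.positive⁻¹ 1ℚ) (p≤p+η 1ℚ 0≤q)

*-cancelˡ-≤ : ∀ {q x y} → 0ℚ ℚ.< q → fromℚ q * x ≤ fromℚ q * y → x ≤ y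
*-cancelˡ-≤ {q} {x} {y} 0<q h = begin
  x                                    ≈⟨ (λ n → sym (1/q*[q*a] (seq x n))) ⟩
  fromℚ (ℚ.1/ q) * (fromℚ q * x)       ≲⟨ *-monoˡ-≤ (ℚ.<⇒≤ (ℚ.positive⁻¹ (ℚ.1/ q) {{ℚ.1/pos⇒pos q}})) h ⟩
  fromℚ (ℚ.1/ q) * (fromℚ q * y)       ≈⟨ (λ n → 1/q*[q*a] (seq y n)) ⟩
  y                                    ∎
  where
  open ≤-Reasoning
  instance
    posq = ℚ.positive 0<q
    nzq = ℚ.pos⇒nonZero q
  1/q*[q*a] : ∀ a → ℚ.1/ q ℚ.* (q ℚ.* a) ≡ a
  1/q*[q*a] a = trans (sym (ℚ.*-assoc (ℚ.1/ q) q a))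
    (trans (cong (ℚ._* a) (ℚ.*-inverseˡ q)) (ℚ.*-identityˡ a))

p+η≰p : ∀ p {η} → 0ℚ ℚ.< η → ¬ p ℚ.+ η ℚ.≤ p
p+η≰p p {η} 0<η h = ℚ.<-irrefl refl (ℚ.<-≤-trans
  (subst (ℚ._< p ℚ.+ η) (ℚ.+-identityʳ p) (ℚ.+-monoʳ-< p 0<η)) h)

<⇒≱ : ∀ {x y} → x < y → ¬ y ≤ x
<⇒≱ {x} {y} (mk< d 0<d (M , f)) (mk≤ g) =
  let N , h = g (½ ℚ.* d) (0<½η 0<d)
      n = M ℕ.⊔ N
  in p+η≰p (seq x n ℚ.+ ½ ℚ.* d) (0<½η 0<d) (begin
    seq x n ℚ.+ ½ ℚ.* d ℚ.+ ½ ℚ.* d   ≡⟨ solve 2 (λ a d → a :+ con ½ :* d :+ con ½ :* d := a :+ d) refl (seq x n) d ⟩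
    seq x n ℚ.+ d                     ≤⟨ f n (ℕ.m≤m⊔n M N) ⟩
    seq y n                           ≤⟨ h n (ℕ.m≤n⊔m M N) ⟩
    seq x n ℚ.+ ½ ℚ.* d               ∎)
  where open ℚ.≤-Reasoning

-- The order is decidable up to any given error, because both sequences are
-- Cauchy; so the failure of y < x forces x ≤ y.
≮⇒≥ : ∀ {x y} → ¬ y < x → x ≤ y
≮⇒≥ {x} {y} y≮x = mk≤ bound
  where
  module _ (η : ℚ) (0<η : 0ℚ ℚ.< η) where
    e = ½ ℚ.* (½ ℚ.* η)
    0<e = 0<½η (0<½η 0<η)
    Mf = cauchy x e 0<e
    Ng = cauchy y e 0<e
    M = proj₁ Mf
    N = proj₁ Ng
    K = M ℕ.⊔ N
    M≤ : ∀ {n} → K ℕ.≤ n → M ℕ.≤ n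
    M≤ = ℕ.m⊔n≤o⇒m≤o M N
    N≤ : ∀ {n} → K ℕ.≤ n → N ℕ.≤ n
    N≤ = ℕ.m⊔n≤o⇒n≤o M N
    xs : ∀ {m n} → K ℕ.≤ m → K ℕ.≤ n → seq x m ℚ.≤ seq x n ℚ.+ e
    xs m≥ n≥ = ∣p-q∣≤η⇒p≤q+η (proj₂ Mf _ _ (M≤ m≥) (M≤ n≥))
    ys : ∀ {m n} → K ℕ.≤ m → K ℕ.≤ n → seq y m ℚ.≤ seq y n ℚ.+ e
    ys m≥ n≥ = ∣p-q∣≤η⇒p≤q+η (proj₂ Ng _ _ (N≤ m≥) (N≤ n≥))
    open ℚ.≤-Reasoning

    bound : ∃[ N ] ∀ n → N ℕ.≤ n → seq x n ℚ.≤ seq y n ℚ.+ η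
    bound with seq x K ℚ.≤? seq y K ℚ.+ ½ ℚ.* η
    ... | yes h = K , λ n n≥ → begin
      seq x n                         ≤⟨ xs n≥ ℕ.≤-refl ⟩
      seq x K ℚ.+ e                   ≤⟨ ℚ.+-monoˡ-≤ e h ⟩
      seq y K ℚ.+ ½ ℚ.* η ℚ.+ e       ≤⟨ ℚ.+-monoˡ-≤ e (ℚ.+-monoˡ-≤ (½ ℚ.* η) (ys ℕ.≤-refl n≥)) ⟩
      seq y n ℚ.+ e ℚ.+ ½ ℚ.* η ℚ.+ e
        ≡⟨ solve 2 (λ a η → a :+ con ½ :* (con ½ :* η) :+ con ½ :* η :+ con ½ :* (con ½ :* η)
                                           := a :+ η) refl (seq y n) η ⟩
      seq y n ℚ.+ η                   ∎
    ... | no ¬h = contradiction (mk< e′ 0<e′ (K , λ n n≥ → begin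
      seq y n ℚ.+ e′                                  ≤⟨ ℚ.+-monoˡ-≤ e′ (ys n≥ ℕ.≤-refl) ⟩
      seq y K ℚ.+ e ℚ.+ e′                            ≡⟨ a+e+e′ (seq y K) (seq x K) ⟩
      seq x K ℚ.- e                                   ≤⟨ p≤q+η⇒p-q≤η (seq x K) e (seq x n)
                                                           (subst (seq x K ℚ.≤_) (ℚ.+-comm (seq x n) e) (xs ℕ.≤-refl n≥)) ⟩
      seq x n                                         ∎)) y≮x
      where
      y+½η<x : seq y K ℚ.+ ½ ℚ.* η ℚ.< seq x K
      y+½η<x = ℚ.≰⇒> ¬h
      e′ = seq x K ℚ.- (seq y K ℚ.+ ½ ℚ.* η)
      0<e′ : 0ℚ ℚ.< e′
      0<e′ = subst (ℚ._< e′) (ℚ.+-inverseʳ (seq y K ℚ.+ ½ ℚ.* η))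
        (ℚ.+-monoˡ-< (ℚ.- (seq y K ℚ.+ ½ ℚ.* η)) y+½η<x)
      a+e+e′ : ∀ a b → a ℚ.+ e ℚ.+ (b ℚ.- (a ℚ.+ ½ ℚ.* η)) ≡ b ℚ.- e
      a+e+e′ a b = solve 3 (λ a b η → a :+ con ½ :* (con ½ :* η) :+ (b :- (a :+ con ½ :* η))
        := b :- con ½ :* (con ½ :* η)) refl a b η

<⇒≤ : ∀ {x y} → x < y → x ≤ y
<⇒≤ {x} {y} (mk< d 0<d (N , f)) = mk≤ λ η 0<η → N , λ n n≥ → ℚ.≤-trans
  (ℚ.≤-trans (p≤p+η (seq x n) (ℚ.<⇒≤ 0<d)) (f n n≥)) (p≤p+η (seq y n) (ℚ.<⇒≤ 0<η))

*-monoʳ-≤ : ∀ {p q x} → 0ℝ ≤ x → p ℚ.≤ q → fromℚ p * x ≤ fromℚ q * x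
*-monoʳ-≤ {p} {q} {x} 0≤x p≤q = begin
  fromℚ p * x                          ≈⟨ (λ n → sym (ℚ.+-identityʳ (p ℚ.* seq x n))) ⟩
  fromℚ p * x + 0ℝ                     ≈⟨ (λ n → cong (p ℚ.* seq x n ℚ.+_) (sym (ℚ.*-zeroʳ (q ℚ.- p)))) ⟩
  fromℚ p * x + fromℚ (q ℚ.- p) * 0ℝ   ≲⟨ +-monoʳ-≤ (fromℚ p * x) (*-monoˡ-≤ 0≤q-p 0≤x) ⟩
  fromℚ p * x + fromℚ (q ℚ.- p) * x
    ≈⟨ (λ n → solve 3 (λ p q x → p :* x :+ (q :- p) :* x := q :* x) refl p q (seq x n)) ⟩
  fromℚ q * x                          ∎
  where
  open ≤-Reasoning
  0≤q-p : 0ℚ ℚ.≤ q ℚ.- p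
  0≤q-p = subst (ℚ._≤ q ℚ.- p) (ℚ.+-inverseʳ p) (ℚ.+-monoˡ-≤ (ℚ.- p) p≤q)

fromℚ-mono-≤ : ∀ {p q} → p ℚ.≤ q → fromℚ p ≤ fromℚ q
fromℚ-mono-≤ h = pointwise (λ _ → h)

fromℚ-cancel-≤ : ∀ {p q} → fromℚ p ≤ fromℚ q → p ℚ.≤ q
fromℚ-cancel-≤ {p} {q} h = ℚ.≮⇒≥ λ q<p → <⇒≱
  (mk< (p ℚ.- q) (subst (ℚ._< p ℚ.- q) (ℚ.+-inverseʳ q) (ℚ.+-monoˡ-< (ℚ.- q) q<p))
    (0 , λ _ _ → ℚ.≤-reflexive (sym (p≡q+[p-q] p q)))) h

-- Natural numbers in ℚ and ℝ

n/1 : ∀ n → toℚᵘ (+ n ℚ./ 1) ℚᵘ.≃ mkℚᵘ (+ n) 0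
n/1 n = ℚ.toℚᵘ-fromℚᵘ (mkℚᵘ (+ n) 0)

[m+n]/1 : ∀ m n → + (m ℕ.+ n) ℚ./ 1 ≡ + m ℚ./ 1 ℚ.+ + n ℚ./ 1
[m+n]/1 m n = ℚ.toℚᵘ-injective (begin
  toℚᵘ (+ (m ℕ.+ n) ℚ./ 1)                     ≈⟨ n/1 (m ℕ.+ n) ⟩
  mkℚᵘ (+ (m ℕ.+ n)) 0
    ≈⟨ *≡* (cong (ℤ._* + 1) (sym (cong₂ ℤ._+_ (ℤ.*-identityʳ (+ m)) (ℤ.*-identityʳ (+ n))))) ⟩
  mkℚᵘ (+ m) 0 ℚᵘ.+ mkℚᵘ (+ n) 0               ≈⟨ ℚᵘ.+-cong (n/1 m) (n/1 n) ⟨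
  toℚᵘ (+ m ℚ./ 1) ℚᵘ.+ toℚᵘ (+ n ℚ./ 1)       ≈⟨ ℚ.toℚᵘ-homo-+ (+ m ℚ./ 1) (+ n ℚ./ 1) ⟨
  toℚᵘ (+ m ℚ./ 1 ℚ.+ + n ℚ./ 1)               ∎)
  where open import Relation.Binary.Reasoning.Setoid ℚᵘ.≃-setoid

[m*n]/1 : ∀ m n → + (m ℕ.* n) ℚ./ 1 ≡ + m ℚ./ 1 ℚ.* (+ n ℚ./ 1)
[m*n]/1 m n = ℚ.toℚᵘ-injective (begin
  toℚᵘ (+ (m ℕ.* n) ℚ./ 1)                     ≈⟨ n/1 (m ℕ.* n) ⟩
  mkℚᵘ (+ (m ℕ.* n)) 0                         ≈⟨ *≡* (cong (ℤ._* + 1) (ℤ.pos-* m n)) ⟩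
  mkℚᵘ (+ m) 0 ℚᵘ.* mkℚᵘ (+ n) 0               ≈⟨ ℚᵘ.*-cong (n/1 m) (n/1 n) ⟨
  toℚᵘ (+ m ℚ./ 1) ℚᵘ.* toℚᵘ (+ n ℚ./ 1)       ≈⟨ ℚ.toℚᵘ-homo-* (+ m ℚ./ 1) (+ n ℚ./ 1) ⟨
  toℚᵘ (+ m ℚ./ 1 ℚ.* (+ n ℚ./ 1))             ∎)
  where open import Relation.Binary.Reasoning.Setoid ℚᵘ.≃-setoid

1/n*n : ∀ n .{{_ : NonZero n}} → + 1 ℚ./ n ℚ.* (+ n ℚ./ 1) ≡ 1ℚ
1/n*n n@(suc m) = ℚ.toℚᵘ-injective (begin
  toℚᵘ (+ 1 ℚ./ n ℚ.* (+ n ℚ./ 1))             ≈⟨ ℚ.toℚᵘ-homo-* (+ 1 ℚ./ n) (+ n ℚ./ 1) ⟩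
  toℚᵘ (+ 1 ℚ./ n) ℚᵘ.* toℚᵘ (+ n ℚ./ 1)       ≈⟨ ℚᵘ.*-cong (ℚ.toℚᵘ-fromℚᵘ (mkℚᵘ (+ 1) m)) (n/1 n) ⟩
  mkℚᵘ (+ 1) m ℚᵘ.* mkℚᵘ (+ n) 0
    ≈⟨ *≡* (cong +_ (trans (ℕ.*-identityʳ (1 ℕ.* n)) (cong (1 ℕ.*_) (sym (ℕ.*-identityʳ n))))) ⟩
  toℚᵘ 1ℚ                                      ∎)
  where open import Relation.Binary.Reasoning.Setoid ℚᵘ.≃-setoid

m/1≤n/1 : ∀ {m n} → m ℕ.≤ n → + m ℚ./ 1 ℚ.≤ + n ℚ./ 1
m/1≤n/1 {m} {n} m≤n = ℚ.toℚᵘ-cancel-≤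
  (ℚᵘ.≤-respʳ-≃ (ℚᵘ.≃-sym (n/1 n)) (ℚᵘ.≤-respˡ-≃ (ℚᵘ.≃-sym (n/1 m))
    (*≤* (ℤ.*-monoʳ-≤-nonNeg (+ 1) (ℤ.+≤+ m≤n)))))

0≤n/1 : ∀ n → 0ℚ ℚ.≤ + n ℚ./ 1
0≤n/1 n = m/1≤n/1 {0} {n} z≤n

0<n/1 : ∀ n .{{_ : NonZero n}} → 0ℚ ℚ.< + n ℚ./ 1
0<n/1 n = ℚ.positive⁻¹ (+ n ℚ./ 1) {{ℚ.normalize-pos n 1}}

fromℕ-mono-≤ : ∀ {m n} → m ℕ.≤ n → fromℕ m ≤ fromℕ n
fromℕ-mono-≤ = fromℚ-mono-≤ ∘ m/1≤n/1

fromℕ-cancel-≤ : ∀ {m n} → fromℕ m ≤ fromℕ n → m ℕ.≤ n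
fromℕ-cancel-≤ {m} {n} h = ℕ.≮⇒≥ λ n<m → p+η≰p (+ n ℚ./ 1) {1ℚ} (ℚ.positive⁻¹ 1ℚ)
  (ℚ.≤-trans (ℚ.≤-reflexive (sym (trans (cong (λ k → + k ℚ./ 1) (ℕ.+-comm 1 n)) ([m+n]/1 n 1))))
    (ℚ.≤-trans (m/1≤n/1 n<m) (fromℚ-cancel-≤ h)))

-- Maxima and reciprocals

z≤x⊔y∧x<z⇒z≤y : ∀ {x y z} → z ≤ x ⊔ y → x < z → z ≤ y
z≤x⊔y∧x<z⇒z≤y {x} {y} {z} (mk≤ f) (mk< d 0<d (M , g)) = mk≤ λ η 0<η →
  let θ = η ℚ.⊓ (½ ℚ.* d)
      N , h = f θ (0<⊓ 0<η (0<½η 0<d))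
  in M ℕ.⊔ N , λ n n≥ →
     one η n (g n (ℕ.m⊔n≤o⇒m≤o M N n≥)) (h n (ℕ.m⊔n≤o⇒n≤o M N n≥))
  where
  0<⊓ : ∀ {p q} → 0ℚ ℚ.< p → 0ℚ ℚ.< q → 0ℚ ℚ.< p ℚ.⊓ q
  0<⊓ {p} {q} 0<p 0<q with ℚ.⊓-sel p q
  ... | inj₁ e = subst (0ℚ ℚ.<_) (sym e) 0<p
  ... | inj₂ e = subst (0ℚ ℚ.<_) (sym e) 0<q
  open ℚ.≤-Reasoning
  one : ∀ η n → seq x n ℚ.+ d ℚ.≤ seq z n →
        seq z n ℚ.≤ (seq x n ℚ.⊔ seq y n) ℚ.+ (η ℚ.⊓ (½ ℚ.* d)) → seq z n ℚ.≤ seq y n ℚ.+ η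
  one η n x+d≤z z≤ with ℚ.⊔-sel (seq x n) (seq y n)
  ... | inj₂ e = begin
    seq z n                                                ≤⟨ z≤ ⟩
    (seq x n ℚ.⊔ seq y n) ℚ.+ (η ℚ.⊓ (½ ℚ.* d))            ≡⟨ cong (ℚ._+ (η ℚ.⊓ (½ ℚ.* d))) e ⟩
    seq y n ℚ.+ (η ℚ.⊓ (½ ℚ.* d))                          ≤⟨ ℚ.+-monoʳ-≤ (seq y n) (ℚ.p⊓q≤p η (½ ℚ.* d)) ⟩
    seq y n ℚ.+ η                                          ∎
  ... | inj₁ e = contradiction (begin
    seq x n ℚ.+ ½ ℚ.* d ℚ.+ ½ ℚ.* d
      ≡⟨ solve 2 (λ a d → a :+ con ½ :* d :+ con ½ :* d := a :+ d) refl (seq x n) d ⟩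
    seq x n ℚ.+ d                                          ≤⟨ x+d≤z ⟩
    seq z n                                                ≤⟨ z≤ ⟩
    (seq x n ℚ.⊔ seq y n) ℚ.+ (η ℚ.⊓ (½ ℚ.* d))            ≡⟨ cong (ℚ._+ (η ℚ.⊓ (½ ℚ.* d))) e ⟩
    seq x n ℚ.+ (η ℚ.⊓ (½ ℚ.* d))                          ≤⟨ ℚ.+-monoʳ-≤ (seq x n) (ℚ.p⊓q≤q η (½ ℚ.* d)) ⟩
    seq x n ℚ.+ ½ ℚ.* d                                    ∎) (p+η≰p (seq x n ℚ.+ ½ ℚ.* d) (0<½η 0<d))

-- The denominators d ⊔ seq x n in recip x are eventually seq x n itself.
recip-inverse : ∀ x (0<x : 0ℝ < x) →
  ∃[ N ] ∀ n → N ℕ.≤ n → seq (recip x 0<x) n ℚ.* seq x n ≡ 1ℚ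
recip-inverse x (mk< d 0<d (N , f)) = N , λ n n≥ →
  trans (cong (1/d⊔ d 0<d (seq x n) ℚ.*_)
          (sym (ℚ.p≤q⇒p⊔q≡q {d} {seq x n} (subst (ℚ._≤ seq x n) (ℚ.+-identityˡ d) (f n n≥)))))
        (1/d⊔-inverse d 0<d (seq x n))

q≤recip⇒qx≤1 : ∀ {q x} (0<x : 0ℝ < x) → fromℚ q ≤ recip x 0<x → fromℚ q * x ≤ 1ℝ
q≤recip⇒qx≤1 {q} {x} 0<x@(mk< d 0<d (N₀ , 0+d≤x)) (mk≤ f) = mk≤ λ η 0<η →
  let B , 0<B , N₁ , x≤B = eventually-bounded x
      θ , 0<θ , θB≡η = divide B η 0<B 0<η
      N₂ , rx≡1 = recip-inverse x 0<x
      N₃ , q≤r = f θ 0<θ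
      K = (N₀ ℕ.⊔ N₁) ℕ.⊔ (N₂ ℕ.⊔ N₃)
  in K , λ n n≥ →
     let n≥₀₁ = ℕ.m⊔n≤o⇒m≤o (N₀ ℕ.⊔ N₁) (N₂ ℕ.⊔ N₃) n≥
         n≥₂₃ = ℕ.m⊔n≤o⇒n≤o (N₀ ℕ.⊔ N₁) (N₂ ℕ.⊔ N₃) n≥
         r = seq (recip x 0<x) n
         a = seq x n
         0≤a = ℚ.≤-trans (ℚ.<⇒≤ 0<d) (subst (ℚ._≤ a) (ℚ.+-identityˡ d) (0+d≤x n (ℕ.m⊔n≤o⇒m≤o N₀ N₁ n≥₀₁)))
     in begin
       q ℚ.* a                ≤⟨ ℚ.*-monoʳ-≤-nonNeg a {{ℚ.nonNegative 0≤a}} (q≤r n (ℕ.m⊔n≤o⇒n≤o N₂ N₃ n≥₂₃)) ⟩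
       (r ℚ.+ θ) ℚ.* a        ≡⟨ ℚ.*-distribʳ-+ a r θ ⟩
       r ℚ.* a ℚ.+ θ ℚ.* a    ≡⟨ cong (ℚ._+ θ ℚ.* a) (rx≡1 n (ℕ.m⊔n≤o⇒m≤o N₂ N₃ n≥₂₃)) ⟩
       1ℚ ℚ.+ θ ℚ.* a         ≤⟨ ℚ.+-monoʳ-≤ 1ℚ (ℚ.*-monoˡ-≤-nonNeg θ {{ℚ.nonNegative (ℚ.<⇒≤ 0<θ)}}
                                   (ℚ.≤-trans (p≤∣p∣ a) (x≤B n (ℕ.m⊔n≤o⇒n≤o N₀ N₁ n≥₀₁)))) ⟩
       1ℚ ℚ.+ θ ℚ.* B         ≡⟨ cong (1ℚ ℚ.+_) θB≡η ⟩
       1ℚ ℚ.+ η               ∎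
  where open ℚ.≤-Reasoning

1≤qx⇒recip≤q : ∀ {q x} (0<x : 0ℝ < x) → 1ℝ ≤ fromℚ q * x → recip x 0<x ≤ fromℚ q
1≤qx⇒recip≤q {q} {x} 0<x (mk≤ f) = mk≤ λ η 0<η →
  let B , 0<B , N₁ , r≤B = eventually-bounded (recip x 0<x)
      θ , 0<θ , θB≡η = divide B η 0<B 0<η
      N₂ , rx≡1 = recip-inverse x 0<x
      N₃ , 1≤qx = f θ 0<θ
      K = N₁ ℕ.⊔ (N₂ ℕ.⊔ N₃)
  in K , λ n n≥ →
     let n≥₂₃ = ℕ.m⊔n≤o⇒n≤o N₁ (N₂ ℕ.⊔ N₃) n≥
         r = seq (recip x 0<x) n
         a = seq x n
     in begin
       r                          ≡⟨ ℚ.*-identityʳ r ⟨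
       r ℚ.* 1ℚ                   ≤⟨ ℚ.*-monoˡ-≤-nonNeg r {{ℚ.nonNegative (0≤r 0<x n)}}
                                       (1≤qx n (ℕ.m⊔n≤o⇒n≤o N₂ N₃ n≥₂₃)) ⟩
       r ℚ.* (q ℚ.* a ℚ.+ θ)      ≡⟨ solve 4 (λ r q a θ → r :* (q :* a :+ θ) := q :* (r :* a) :+ θ :* r)
                                       refl r q a θ ⟩
       q ℚ.* (r ℚ.* a) ℚ.+ θ ℚ.* r ≡⟨ cong (λ u → q ℚ.* u ℚ.+ θ ℚ.* r) (rx≡1 n (ℕ.m⊔n≤o⇒m≤o N₂ N₃ n≥₂₃)) ⟩
       q ℚ.* 1ℚ ℚ.+ θ ℚ.* r       ≡⟨ cong (ℚ._+ θ ℚ.* r) (ℚ.*-identityʳ q) ⟩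
       q ℚ.+ θ ℚ.* r              ≤⟨ ℚ.+-monoʳ-≤ q (ℚ.*-monoˡ-≤-nonNeg θ {{ℚ.nonNegative (ℚ.<⇒≤ 0<θ)}}
                                       (ℚ.≤-trans (p≤∣p∣ r) (r≤B n (ℕ.m⊔n≤o⇒m≤o N₁ (N₂ ℕ.⊔ N₃) n≥)))) ⟩
       q ℚ.+ θ ℚ.* B              ≡⟨ cong (q ℚ.+_) θB≡η ⟩
       q ℚ.+ η                    ∎
  where
  open ℚ.≤-Reasoning
  0≤r : ∀ (0<x : 0ℝ < x) n → 0ℚ ℚ.≤ seq (recip x 0<x) n
  0≤r (mk< d 0<d _) n = 1/d⊔-nonNeg d 0<d (seq x n)

-- Logarithms

log₂W≤1+⌊log₂W⌋ : ∀ W .{{_ : NonZero W}} → log₂ W ≤ fromℕ ⌊log₂ W ⌋ + 1ℝ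
log₂W≤1+⌊log₂W⌋ W = pointwise λ n →
  a/i≤b/j+1/j ⌊log₂ W ℕ.^ suc n ⌋ ⌊log₂ W ⌋ n 0
    (subst (λ w → ⌊log₂ W ℕ.^ suc n ⌋ ℕ.* 1 ℕ.≤ suc ⌊log₂ w ⌋ ℕ.* suc n)
      (ℕ.^-identityʳ W) (⌊log₂W^i⌋j≤[1+⌊log₂W^j⌋]i W (suc n) 1))

2^-cancel-≤ : ∀ {m n} → 2 ℕ.^ m ℕ.≤ 2 ℕ.^ n → m ℕ.≤ n
2^-cancel-≤ {m} {n} h = subst₂ ℕ._≤_ (⌊log₂[2^n]⌋≡n m) (⌊log₂[2^n]⌋≡n n) (⌊log₂⌋-mono-≤ h)

2^-cancel-< : ∀ {m n} → 2 ℕ.^ m ℕ.< 2 ℕ.^ n → m ℕ.< n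
2^-cancel-< h = ℕ.≰⇒> λ n≤m → ℕ.<⇒≱ h (ℕ.^-monoʳ-≤ 2 n≤m)

-- (1 + 1/w)^n ≥ 1 + n/w
bernoulli : ∀ w n → w ℕ.^ n ℕ.* (w ℕ.+ n) ℕ.≤ suc w ℕ.^ n ℕ.* w
bernoulli w zero    = ℕ.≤-reflexive (cong (1 ℕ.*_) (ℕ.+-identityʳ w))
bernoulli w (suc n) = begin
  w ℕ.* p ℕ.* (w ℕ.+ suc n)              ≤⟨ ℕ.m≤m+n _ (p ℕ.* n) ⟩
  w ℕ.* p ℕ.* (w ℕ.+ suc n) ℕ.+ p ℕ.* n  ≡⟨ expand w n p ⟩
  suc w ℕ.* (p ℕ.* (w ℕ.+ n))            ≤⟨ ℕ.*-monoʳ-≤ (suc w) (bernoulli w n) ⟩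
  suc w ℕ.* (suc w ℕ.^ n ℕ.* w)          ≡⟨ ℕ.*-assoc (suc w) (suc w ℕ.^ n) w ⟨
  suc w ℕ.^ suc n ℕ.* w                  ∎
  where
  open ℕ.≤-Reasoning
  p = w ℕ.^ n
  expand : ∀ w n p → w ℕ.* p ℕ.* (w ℕ.+ suc n) ℕ.+ p ℕ.* n ≡ suc w ℕ.* (p ℕ.* (w ℕ.+ n))
  expand = solve-∀

2w^w≤[1+w]^w : ∀ w .{{_ : NonZero w}} → 2 ℕ.* w ℕ.^ w ℕ.≤ suc w ℕ.^ w
2w^w≤[1+w]^w w = ℕ.*-cancelʳ-≤ _ _ w (begin
  2 ℕ.* w ℕ.^ w ℕ.* w        ≡⟨ double (w ℕ.^ w) w ⟩
  w ℕ.^ w ℕ.* (w ℕ.+ w)      ≤⟨ bernoulli w w ⟩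
  suc w ℕ.^ w ℕ.* w          ∎)
  where
  open ℕ.≤-Reasoning
  double : ∀ p w → 2 ℕ.* p ℕ.* w ≡ p ℕ.* (w ℕ.+ w)
  double = solve-∀

m/n≡m*1/n : ∀ m n → + m ℚ./ suc n ≡ + m ℚ./ 1 ℚ.* (+ 1 ℚ./ suc n)
m/n≡m*1/n m n = ℚ.toℚᵘ-injective (begin
  toℚᵘ (+ m ℚ./ suc n)                           ≈⟨ ℚ.toℚᵘ-fromℚᵘ (mkℚᵘ (+ m) n) ⟩
  mkℚᵘ (+ m) n
    ≈⟨ *≡* (cong₂ ℤ._*_ (sym (ℤ.*-identityʳ (+ m))) (cong +_ (ℕ.*-identityˡ (suc n)))) ⟩
  mkℚᵘ (+ m) 0 ℚᵘ.* mkℚᵘ (+ 1) n                 ≈⟨ ℚᵘ.*-cong (n/1 m) (ℚ.toℚᵘ-fromℚᵘ (mkℚᵘ (+ 1) n)) ⟨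
  toℚᵘ (+ m ℚ./ 1) ℚᵘ.* toℚᵘ (+ 1 ℚ./ suc n)     ≈⟨ ℚ.toℚᵘ-homo-* (+ m ℚ./ 1) (+ 1 ℚ./ suc n) ⟨
  toℚᵘ (+ m ℚ./ 1 ℚ.* (+ 1 ℚ./ suc n))           ∎)
  where open import Relation.Binary.Reasoning.Setoid ℚᵘ.≃-setoid

-- ⌊log₂ W^2W⌋ / 2W is at most k - 2/(2W), because 4 W^2W ≤ (W + 1)^2W ≤ 2^2kW, and
-- every other term of the sequence exceeds it by at most 1/(2W).
W<2^k⇒log₂W<k : ∀ W .{{_ : NonZero W}} {k} → W ℕ.< 2 ℕ.^ k → log₂ W < fromℕ k
W<2^k⇒log₂W<k W@(suc w) {k} W<2^k = mk< i (0<1/n L) (0 , λ n _ → begin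
  seq (log₂ W) n ℚ.+ i             ≤⟨ ℚ.+-monoˡ-≤ i (a/i≤b/j+1/j ⌊log₂ W ℕ.^ suc n ⌋ b n j
                                        (⌊log₂W^i⌋j≤[1+⌊log₂W^j⌋]i W (suc n) L)) ⟩
  + b ℚ./ L ℚ.+ i ℚ.+ i            ≡⟨ cong (λ u → u ℚ.+ i ℚ.+ i) (m/n≡m*1/n b j) ⟩
  + b ℚ./ 1 ℚ.* i ℚ.+ i ℚ.+ i
    ≡⟨ solve 2 (λ b i → b :* i :+ i :+ i := (b :+ con (+ 2 ℚ./ 1)) :* i) refl (+ b ℚ./ 1) i ⟩
  (+ b ℚ./ 1 ℚ.+ + 2 ℚ./ 1) ℚ.* i  ≡⟨ cong (ℚ._* i) ([m+n]/1 b 2) ⟨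
  + (b ℕ.+ 2) ℚ./ 1 ℚ.* i          ≤⟨ ℚ.*-monoʳ-≤-nonNeg i {{ℚ.nonNegative (ℚ.<⇒≤ (0<1/n L))}}
                                        (m/1≤n/1 {b ℕ.+ 2} {k ℕ.* L} (2^-cancel-≤ {b ℕ.+ 2} {k ℕ.* L} 2^[b+2]≤2^kL)) ⟩
  + (k ℕ.* L) ℚ./ 1 ℚ.* i          ≡⟨ cong (ℚ._* i) ([m*n]/1 k L) ⟩
  + k ℚ./ 1 ℚ.* (+ L ℚ./ 1) ℚ.* i
    ≡⟨ solve 3 (λ k L i → k :* L :* i := k :* (i :* L)) refl (+ k ℚ./ 1) (+ L ℚ./ 1) i ⟩
  + k ℚ./ 1 ℚ.* (i ℚ.* (+ L ℚ./ 1)) ≡⟨ cong (+ k ℚ./ 1 ℚ.*_) (1/n*n L) ⟩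
  + k ℚ./ 1 ℚ.* 1ℚ                 ≡⟨ ℚ.*-identityʳ _ ⟩
  + k ℚ./ 1                        ∎)
  where
  open ℚ.≤-Reasoning
  L = W ℕ.+ W
  j = w ℕ.+ W
  i = + 1 ℚ./ L
  b = ⌊log₂ W ℕ.^ L ⌋
  2^[b+2]≤2^kL : 2 ℕ.^ (b ℕ.+ 2) ℕ.≤ 2 ℕ.^ (k ℕ.* L)
  2^[b+2]≤2^kL = R.begin
    2 ℕ.^ (b ℕ.+ 2)                          R.≡⟨ ℕ.^-distribˡ-+-* 2 b 2 ⟩
    2 ℕ.^ b ℕ.* 4                            R.≤⟨ ℕ.*-monoˡ-≤ 4 (2^⌊log₂n⌋≤n (W ℕ.^ L) {{ℕ.m^n≢0 W L}}) ⟩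
    W ℕ.^ L ℕ.* 4                            R.≡⟨ cong (ℕ._* 4) (ℕ.^-distribˡ-+-* W W W) ⟩
    W ℕ.^ W ℕ.* W ℕ.^ W ℕ.* 4                R.≡⟨ four (W ℕ.^ W) ⟩
    (2 ℕ.* W ℕ.^ W) ℕ.* (2 ℕ.* W ℕ.^ W)      R.≤⟨ ℕ.*-mono-≤ (2w^w≤[1+w]^w W) (2w^w≤[1+w]^w W) ⟩
    suc W ℕ.^ W ℕ.* suc W ℕ.^ W              R.≡⟨ ℕ.^-distribˡ-+-* (suc W) W W ⟨
    suc W ℕ.^ L                              R.≤⟨ ℕ.^-monoˡ-≤ L W<2^k ⟩
    (2 ℕ.^ k) ℕ.^ L                          R.≡⟨ ℕ.^-*-assoc 2 k L ⟩
    2 ℕ.^ (k ℕ.* L)                          R.∎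
    where
    module R = ℕ.≤-Reasoning
    four : ∀ p → p ℕ.* p ℕ.* 4 ≡ (2 ℕ.* p) ℕ.* (2 ℕ.* p)
    four = solve-∀

-- Probability

module Probability (space : ProbabilitySpace) where
  open ProbabilitySpace space

  ∅ : Event
  ∅ = ∁ full

  ∉∅ : ∀ ω → ¬ ω ∈ ∅
  ∉∅ ω h = to (∈∁ full ω) h (∈full ω)

  ∈∩ˡ : ∀ {E F ω} → ω ∈ (E ∩ F) → ω ∈ E
  ∈∩ˡ {E} {F} {ω} h = proj₁ (to (∈∩ E F ω) h)

  ∈∩ʳ : ∀ {E F ω} → ω ∈ (E ∩ F) → ω ∈ F
  ∈∩ʳ {E} {F} {ω} h = proj₂ (to (∈∩ E F ω) h)

  P-empty : ∀ E → (∀ ω → ¬ ω ∈ E) → P E ≤ 0ℝ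
  P-empty E empty = +-cancelʳ-≤ (P E) (begin
    P E + P E          ≈⟨ (λ n → cong (ℚ._+ seq (P E) n) (sym (ℚ.+-identityˡ (seq (P E) n)))) ⟩
    0ℝ + P E + P E     ≲⟨ proj₁ (P-∪ (λ _ → E) E
                           ( (λ _ _ _ ω h → empty ω (proj₁ h))
                           , (λ _ _ h → h)
                           , (λ ω h → contradiction h (empty ω)))) 2 ⟩
    P E                ≈⟨ (λ n → sym (ℚ.+-identityˡ (seq (P E) n))) ⟩
    0ℝ + P E           ∎)
    where open ≤-Reasoning

  -- Finite additivity, for U the disjoint union of E and F.
  module _ (E F U : Event) (disjoint : ∀ ω → ω ∈ E → ¬ ω ∈ F)
           (E⊆U : ∀ ω → ω ∈ E → ω ∈ U) (F⊆U : ∀ ω → ω ∈ F → ω ∈ U)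
           (U⊆E∪F : ∀ ω → ω ∈ U → ¬ ω ∈ E → ¬ ω ∈ F → ⊥) where

    private
      E,F,∅… : ℕ → Event
      E,F,∅… zero          = E
      E,F,∅… (suc zero)    = F
      E,F,∅… (suc (suc _)) = ∅

      isDisjointUnion : IsDisjointUnion E,F,∅… U
      isDisjointUnion = disj , sub , cover
        where
        disj : ∀ i j → i ≢ j → ∀ ω → ¬ (ω ∈ E,F,∅… i × ω ∈ E,F,∅… j)
        disj zero          zero          i≢j ω _       = i≢j refl
        disj zero          (suc zero)    i≢j ω (h , k) = disjoint ω h k
        disj (suc zero)    zero          i≢j ω (h , k) = disjoint ω k h
        disj (suc zero)    (suc zero)    i≢j ω _       = i≢j refl
        disj (suc (suc _)) _             i≢j ω (h , _) = ∉∅ ω h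
        disj _             (suc (suc _)) i≢j ω (_ , k) = ∉∅ ω k
        sub : ∀ i ω → ω ∈ E,F,∅… i → ω ∈ U
        sub zero          ω h = E⊆U ω h
        sub (suc zero)    ω h = F⊆U ω h
        sub (suc (suc _)) ω h = contradiction h (∉∅ ω)
        cover : ∀ ω → ω ∈ U → ¬ ¬ (∃[ i ] ω ∈ E,F,∅… i)
        cover ω h none = U⊆E∪F ω h (λ e → none (0 , e)) (λ f → none (1 , f))

    P[E]+P[F]≤P[U] : P E + P F ≤ P U
    P[E]+P[F]≤P[U] = ≤-trans
      (≈⇒≤ (λ n → cong (ℚ._+ seq (P F) n) (sym (ℚ.+-identityˡ (seq (P E) n)))))
      (proj₁ (P-∪ E,F,∅… U isDisjointUnion) 2)

    P[U]≤P[E]+P[F] : P U ≤ P E + P F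
    P[U]≤P[E]+P[F] = proj₂ (P-∪ E,F,∅… U isDisjointUnion) (P E + P F) bound
      where
      open ≤-Reasoning
      bound : ∀ n → partialSums (P ∘ E,F,∅…) n ≤ P E + P F
      bound zero = begin
        0ℝ           ≈⟨ (λ _ → sym (ℚ.+-identityˡ 0ℚ)) ⟩
        0ℝ + 0ℝ      ≲⟨ +-mono-≤ (P-pos E) (P-pos F) ⟩
        P E + P F    ∎
      bound (suc zero) = begin
        0ℝ + P E     ≈⟨ (λ n → ℚ.+-comm 0ℚ (seq (P E) n)) ⟩
        P E + 0ℝ     ≲⟨ +-monoʳ-≤ (P E) (P-pos F) ⟩
        P E + P F    ∎
      bound (suc (suc zero)) = begin
        0ℝ + P E + P F   ≈⟨ (λ n → cong (ℚ._+ seq (P F) n) (ℚ.+-identityˡ (seq (P E) n))) ⟩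
        P E + P F        ∎
      bound (suc (suc (suc n))) = begin
        partialSums (P ∘ E,F,∅…) (suc (suc n)) + P ∅   ≲⟨ +-mono-≤ (bound (suc (suc n))) (P-empty ∅ ∉∅) ⟩
        P E + P F + 0ℝ                                 ≈⟨ (λ k → ℚ.+-identityʳ (seq (P E + P F) k)) ⟩
        P E + P F                                      ∎

  split≥ : ∀ E F → P (E ∩ F) + P (∁ E ∩ F) ≤ P F
  split≥ E F = P[E]+P[F]≤P[U] (E ∩ F) (∁ E ∩ F) F
    (λ ω h k → to (∈∁ E ω) (∈∩ˡ k) (∈∩ˡ h)) (λ _ → ∈∩ʳ) (λ _ → ∈∩ʳ)
    (λ ω f ¬EF ¬∁EF → ¬∁EF (from (∈∩ (∁ E) F ω)
      (from (∈∁ E ω) (λ e → ¬EF (from (∈∩ E F ω) (e , f))) , f)))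

  split≤ : ∀ E F → P F ≤ P (E ∩ F) + P (∁ E ∩ F)
  split≤ E F = P[U]≤P[E]+P[F] (E ∩ F) (∁ E ∩ F) F
    (λ ω h k → to (∈∁ E ω) (∈∩ˡ k) (∈∩ˡ h)) (λ _ → ∈∩ʳ) (λ _ → ∈∩ʳ)
    (λ ω f ¬EF ¬∁EF → ¬∁EF (from (∈∩ (∁ E) F ω)
      (from (∈∁ E ω) (λ e → ¬EF (from (∈∩ E F ω) (e , f))) , f)))

  P-mono : ∀ {E F} → (∀ ω → ω ∈ E → ω ∈ F) → P E ≤ P F
  P-mono {E} {F} E⊆F = begin
    P E                    ≈⟨ (λ n → sym (ℚ.+-identityʳ (seq (P E) n))) ⟩
    P E + 0ℝ               ≲⟨ +-monoʳ-≤ (P E) (P-pos (∁ E ∩ F)) ⟩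
    P E + P (∁ E ∩ F)      ≲⟨ P[E]+P[F]≤P[U] E (∁ E ∩ F) F
                                (λ ω e k → to (∈∁ E ω) (∈∩ˡ k) e) E⊆F (λ _ → ∈∩ʳ)
                                (λ ω f ¬E ¬∁EF → ¬∁EF (from (∈∩ (∁ E) F ω) (from (∈∁ E ω) ¬E , f))) ⟩
    P F                    ∎
    where open ≤-Reasoning

  P[E]+P[∁E]≤1 : ∀ E → P E + P (∁ E) ≤ 1ℝ
  P[E]+P[∁E]≤1 E = ≤-trans
    (P[E]+P[F]≤P[U] E (∁ E) full (λ ω e k → to (∈∁ E ω) k e)
      (λ ω _ → ∈full ω) (λ ω _ → ∈full ω) (λ ω _ ¬E ¬∁E → ¬∁E (from (∈∁ E ω) ¬E)))
    (proj₁ P-full)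

  1≤P[E]+P[∁E] : ∀ E → 1ℝ ≤ P E + P (∁ E)
  1≤P[E]+P[∁E] E = ≤-trans (proj₂ P-full)
    (P[U]≤P[E]+P[F] E (∁ E) full (λ ω e k → to (∈∁ E ω) k e)
      (λ ω _ → ∈full ω) (λ ω _ → ∈full ω) (λ ω _ ¬E ¬∁E → ¬∁E (from (∈∁ E ω) ¬E)))

  P[F]≤P[E∩F]+δ : ∀ {δ} E F → 1ℝ - δ ≤ P E → P F ≤ P (E ∩ F) + δ
  P[F]≤P[E∩F]+δ {δ} E F 1-δ≤P[E] = begin
    P F                                      ≲⟨ split≤ E F ⟩
    P (E ∩ F) + P (∁ E ∩ F)                  ≲⟨ +-monoʳ-≤ (P (E ∩ F)) (≤-trans (P-mono (λ _ → ∈∩ˡ)) P[∁E]≤δ) ⟩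
    P (E ∩ F) + δ                            ∎
    where
    open ≤-Reasoning
    P[∁E]≤δ : P (∁ E) ≤ δ
    P[∁E]≤δ = +-cancelʳ-≤ (1ℝ - δ) (begin
      P (∁ E) + (1ℝ - δ)   ≲⟨ +-monoʳ-≤ (P (∁ E)) 1-δ≤P[E] ⟩
      P (∁ E) + P E        ≈⟨ (λ n → ℚ.+-comm (seq (P (∁ E)) n) (seq (P E) n)) ⟩
      P E + P (∁ E)        ≲⟨ P[E]+P[∁E]≤1 E ⟩
      1ℝ                   ≈⟨ (λ n → solve 1 (λ d → con 1ℚ := d :+ (con 1ℚ :- d)) refl (seq δ n)) ⟩
      δ + (1ℝ - δ)         ∎)

  module _ {I : Set} (E : I → Event) where

    -- The sum of the probabilities of E i ∩ F, i ranging over is.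
    ΣP : List I → Event → ℝ
    ΣP is F = foldr (λ i s → P (E i ∩ F) + s) 0ℝ is

    -- No point of F lies in more than M of the events E i, i ranging over is.
    AtMost : ℕ → List I → Event → Set
    AtMost M is F = ∀ js → js ⊆ is → length js ≡ suc M →
                    ∀ ω → ω ∈ F → ¬ All (λ j → ω ∈ E j) js

    ΣP-split : ∀ is G F → ΣP is F ≤ ΣP is (G ∩ F) + ΣP is (∁ G ∩ F)
    ΣP-split []       G F = ≈⇒≤ (λ _ → sym (ℚ.+-identityˡ 0ℚ))
    ΣP-split (i ∷ is) G F = begin
      P (E i ∩ F) + ΣP is F
        ≲⟨ +-mono-≤ (split≤ G (E i ∩ F)) (ΣP-split is G F) ⟩
      (P (G ∩ (E i ∩ F)) + P (∁ G ∩ (E i ∩ F))) + (ΣP is (G ∩ F) + ΣP is (∁ G ∩ F))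
        ≲⟨ +-monoˡ-≤ (ΣP is (G ∩ F) + ΣP is (∁ G ∩ F)) (+-mono-≤ (P-mono (λ _ → swap)) (P-mono (λ _ → swap))) ⟩
      (P (E i ∩ (G ∩ F)) + P (E i ∩ (∁ G ∩ F))) + (ΣP is (G ∩ F) + ΣP is (∁ G ∩ F))
        ≈⟨ (λ n → solve 4 (λ a b c d → (a :+ b) :+ (c :+ d) := (a :+ c) :+ (b :+ d)) refl
             (seq (P (E i ∩ (G ∩ F))) n) (seq (P (E i ∩ (∁ G ∩ F))) n)
             (seq (ΣP is (G ∩ F)) n) (seq (ΣP is (∁ G ∩ F)) n)) ⟩
      (P (E i ∩ (G ∩ F)) + ΣP is (G ∩ F)) + (P (E i ∩ (∁ G ∩ F)) + ΣP is (∁ G ∩ F)) ∎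
      where
      open ≤-Reasoning
      swap : ∀ {H ω} → ω ∈ (H ∩ (E i ∩ F)) → ω ∈ (E i ∩ (H ∩ F))
      swap h = from (∈∩ _ _ _) (∈∩ˡ (∈∩ʳ h) , from (∈∩ _ _ _) (∈∩ˡ h , ∈∩ʳ (∈∩ʳ h)))

    -- Double counting: the left side is the expectation, restricted to F, of the
    -- number of events that occur.  Induction on the list, splitting F by its first
    -- event: where that event occurs, at most M - 1 of the others do.
    ΣP≤M*P[F] : ∀ M is F → AtMost M is F → ΣP is F ≤ fromℕ M * P F
    ΣP≤M*P[F] M [] F _ = begin
      0ℝ                 ≈⟨ (λ _ → sym (ℚ.*-zeroʳ (+ M ℚ./ 1))) ⟩
      fromℕ M * 0ℝ       ≲⟨ *-monoˡ-≤ (0≤n/1 M) (P-pos F) ⟩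
      fromℕ M * P F      ∎
      where open ≤-Reasoning
    ΣP≤M*P[F] zero (i ∷ is) F few = begin
      P (E i ∩ F) + ΣP is F
        ≲⟨ +-mono-≤ (P-empty (E i ∩ F) (λ ω h → few (i ∷ []) (refl ∷ minimum is) refl ω (∈∩ʳ h) (∈∩ˡ h ∷ [])))
                    (ΣP≤M*P[F] zero is F (λ js js⊆is → few js (i ∷ʳ js⊆is))) ⟩
      0ℝ + fromℕ 0 * P F  ≈⟨ (λ n → ℚ.+-identityˡ (0ℚ ℚ.* seq (P F) n)) ⟩
      fromℕ 0 * P F       ∎
      where open ≤-Reasoning
    ΣP≤M*P[F] (suc M) (i ∷ is) F few = begin
      P G + ΣP is F
        ≲⟨ +-monoʳ-≤ (P G) (ΣP-split is (E i) F) ⟩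
      P G + (ΣP is G + ΣP is H)
        ≲⟨ +-monoʳ-≤ (P G) (+-mono-≤
             (ΣP≤M*P[F] M is G λ js js⊆is len ω h all →
               few (i ∷ js) (refl ∷ js⊆is) (cong suc len) ω (∈∩ʳ h) (∈∩ˡ h ∷ all))
             (ΣP≤M*P[F] (suc M) is H λ js js⊆is len ω h → few js (i ∷ʳ js⊆is) len ω (∈∩ʳ h))) ⟩
      P G + (fromℕ M * P G + fromℕ (suc M) * P H)
        ≈⟨ (λ n → collect (seq (P G) n) (seq (P H) n)) ⟩
      fromℕ (suc M) * (P G + P H)
        ≲⟨ *-monoˡ-≤ (0≤n/1 (suc M)) (split≥ (E i) F) ⟩
      fromℕ (suc M) * P F ∎
      where
      open ≤-Reasoning
      G = E i ∩ F
      H = ∁ (E i) ∩ F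
      collect : ∀ g h → g ℚ.+ (+ M ℚ./ 1 ℚ.* g ℚ.+ + suc M ℚ./ 1 ℚ.* h) ≡ + suc M ℚ./ 1 ℚ.* (g ℚ.+ h)
      collect g h = trans
        (cong (λ u → g ℚ.+ (+ M ℚ./ 1 ℚ.* g ℚ.+ u ℚ.* h)) ([m+n]/1 1 M))
        (trans (solve 3 (λ m g h → g :+ (m :* g :+ (con 1ℚ :+ m) :* h) := (con 1ℚ :+ m) :* (g :+ h))
                  refl (+ M ℚ./ 1) g h)
               (cong (ℚ._* (g ℚ.+ h)) (sym ([m+n]/1 1 M))))

    -- N is the length of the list.
    N*P[F]≤ΣP+N*δ : ∀ {δ} is F → (∀ i → 1ℝ - δ ≤ P (E i)) →
                    fromℕ (length is) * P F ≤ ΣP is F + fromℕ (length is) * δ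
    N*P[F]≤ΣP+N*δ {δ} [] F _ = ≈⇒≤ λ n →
      solve 2 (λ p d → con 0ℚ :* p := con 0ℚ :+ con 0ℚ :* d) refl (seq (P F) n) (seq δ n)
    N*P[F]≤ΣP+N*δ {δ} (i ∷ is) F likely = begin
      fromℕ (suc N) * P F
        ≈⟨ (λ n → one+ (seq (P F) n)) ⟩
      P F + fromℕ N * P F
        ≲⟨ +-mono-≤ (P[F]≤P[E∩F]+δ (E i) F (likely i)) (N*P[F]≤ΣP+N*δ is F likely) ⟩
      (P (E i ∩ F) + δ) + (ΣP is F + fromℕ N * δ)
        ≈⟨ (λ n → solve 4 (λ a d s t → (a :+ d) :+ (s :+ t) := (a :+ s) :+ (d :+ t)) refl
             (seq (P (E i ∩ F)) n) (seq δ n) (seq (ΣP is F) n) (+ N ℚ./ 1 ℚ.* seq δ n)) ⟩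
      ΣP (i ∷ is) F + (δ + fromℕ N * δ)
        ≈⟨ (λ n → cong (seq (ΣP (i ∷ is) F) n ℚ.+_) (sym (one+ (seq δ n)))) ⟩
      ΣP (i ∷ is) F + fromℕ (suc N) * δ ∎
      where
      open ≤-Reasoning
      N = length is
      one+ : ∀ p → + suc N ℚ./ 1 ℚ.* p ≡ p ℚ.+ + N ℚ./ 1 ℚ.* p
      one+ p = trans (cong (ℚ._* p) ([m+n]/1 1 N))
        (trans (ℚ.*-distribʳ-+ p 1ℚ (+ N ℚ./ 1)) (cong (ℚ._+ + N ℚ./ 1 ℚ.* p) (ℚ.*-identityˡ p)))

-- Deterministic algorithms

-- The configuration reached after reading a stream.
run : (A : Algorithm) → Stream → Fin (Algorithm.configs A)
run A = foldl (Algorithm.step A) (Algorithm.initial A)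

run-++ : ∀ A {R R′} Q → run A R ≡ run A R′ → run A (R ++ Q) ≡ run A (R′ ++ Q)
run-++ A {R} {R′} Q h = trans (foldl-++ step initial R Q)
  (trans (cong (λ c → foldl step c Q) h) (sym (foldl-++ step initial R′ Q)))
  where open Algorithm A

-- The number of ones in a stream.
ones : Stream → ℕ
ones = length ∘ filterᵇ id

ones-++ : ∀ R Q → ones (R ++ Q) ≡ ones R ℕ.+ ones Q
ones-++ []          Q = refl
ones-++ (true  ∷ R) Q = cong suc (ones-++ R Q)
ones-++ (false ∷ R) Q = ones-++ R Q

ones-true : ∀ n → ones (replicate n true) ≡ n
ones-true zero    = refl
ones-true (suc n) = cong suc (ones-true n)

ones-false : ∀ n → ones (replicate n false) ≡ 0
ones-false zero    = refl
ones-false (suc n) = ones-false n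

drop-length-++ : ∀ (R : Stream) Q → drop (length R) (R ++ Q) ≡ Q
drop-length-++ []      Q = refl
drop-length-++ (_ ∷ R) Q = drop-length-++ R Q

windowCount-++ : ∀ W R Q → length Q ≡ W → windowCount W (R ++ Q) ≡ ones Q
windowCount-++ W R Q len = cong ones (trans
  (cong (λ k → drop k (R ++ Q)) (begin
    length (R ++ Q) ℕ.∸ W          ≡⟨ cong₂ ℕ._∸_ (length-++ R) (sym len) ⟩
    length R ℕ.+ length Q ℕ.∸ length Q  ≡⟨ ℕ.m+n∸n≡m (length R) (length Q) ⟩
    length R                       ∎))
  (drop-length-++ R Q))
  where open ≡-Reasoning

-- Two moments, perhaps in different streams, that share a configuration get one
-- answer, which is within Wε of both counts.
same-config⇒close : ∀ {W ε A S S′ R R′ T T′ g} →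
  CorrectOn W ε A S → CorrectOn W ε A S′ → R ++ T ≡ S → R′ ++ T′ ≡ S′ →
  run A R ≡ run A R′ → windowCount W R ≡ g ℕ.+ windowCount W R′ →
  fromℕ g ≤ fromℕ 2 * (fromℕ W * ε)
same-config⇒close {W} {ε} {A} {R = R} {R′} {T} {T′} {g} ok ok′ eq eq′ same count = begin
  fromℕ g
    ≲⟨ pointwise (λ n → triangle (seq (answerAfter A R) n)) ⟩
  ∣ answerAfter A R - fromℕ (windowCount W R) ∣ + ∣ answerAfter A R - fromℕ (windowCount W R′) ∣
    ≲⟨ +-mono-≤ (ok R T eq) (subst (λ a → ∣ a - fromℕ (windowCount W R′) ∣ ≤ fromℕ W * ε)
         (cong (Algorithm.answer A) (sym same)) (ok′ R′ T′ eq′)) ⟩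
  fromℕ W * ε + fromℕ W * ε
    ≈⟨ (λ n → solve 1 (λ a → a :+ a := con (+ 2 ℚ./ 1) :* a) refl (seq (fromℕ W * ε) n)) ⟩
  fromℕ 2 * (fromℕ W * ε) ∎
  where
  open ≤-Reasoning
  c = + windowCount W R ℚ./ 1
  c′ = + windowCount W R′ ℚ./ 1
  triangle : ∀ a → + g ℚ./ 1 ℚ.≤ ℚ.∣ a ℚ.- c ∣ ℚ.+ ℚ.∣ a ℚ.- c′ ∣
  triangle a = Q.begin
    + g ℚ./ 1
      Q.≡⟨ solve 3 (λ g c′ a → g := (:- (a :- (g :+ c′))) :+ (a :- c′)) refl (+ g ℚ./ 1) c′ a ⟩
    ℚ.- (a ℚ.- (+ g ℚ./ 1 ℚ.+ c′)) ℚ.+ (a ℚ.- c′)    Q.≡⟨ cong (λ u → ℚ.- (a ℚ.- u) ℚ.+ (a ℚ.- c′))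
                                                           (trans (sym ([m+n]/1 g (windowCount W R′))) (cong (λ k → + k ℚ./ 1) (sym count))) ⟩
    ℚ.- (a ℚ.- c) ℚ.+ (a ℚ.- c′)
      Q.≤⟨ ℚ.+-mono-≤ {ℚ.- (a ℚ.- c)} {ℚ.∣ a ℚ.- c ∣} {a ℚ.- c′} {ℚ.∣ a ℚ.- c′ ∣}
                                                           (subst (ℚ.- (a ℚ.- c) ℚ.≤_) (ℚ.∣-p∣≡∣p∣ (a ℚ.- c)) (p≤∣p∣ (ℚ.- (a ℚ.- c))))
                                                           (p≤∣p∣ (a ℚ.- c′)) ⟩
    ℚ.∣ a ℚ.- c ∣ ℚ.+ ℚ.∣ a ℚ.- c′ ∣                 Q.∎
    where module Q = ℚ.≤-Reasoning

m≤2Wε⇒2m≤W : ∀ {W ε} → ε ≤ 4 ⁻¹ → ∀ m → fromℕ m ≤ fromℕ 2 * (fromℕ W * ε) → 2 ℕ.* m ℕ.≤ W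
m≤2Wε⇒2m≤W {W} {ε} ε≤¼ m m≤2Wε = fromℕ-cancel-≤ {2 ℕ.* m} {W} (begin
  fromℕ (2 ℕ.* m)                          ≈⟨ (λ _ → [m*n]/1 2 m) ⟩
  fromℕ 2 * fromℕ m                        ≲⟨ *-monoˡ-≤ (0≤n/1 2) m≤2Wε ⟩
  fromℕ 2 * (fromℕ 2 * (fromℕ W * ε))      ≲⟨ *-monoˡ-≤ (0≤n/1 2) (*-monoˡ-≤ (0≤n/1 2) (*-monoˡ-≤ (0≤n/1 W) ε≤¼)) ⟩
  fromℕ 2 * (fromℕ 2 * (fromℕ W * 4 ⁻¹))
    ≈⟨ (λ _ → solve 1 (λ w → con (+ 2 ℚ./ 1) :* (con (+ 2 ℚ./ 1) :* (w :* con (+ 1 ℚ./ 4))) := w)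
                                                refl (+ W ℚ./ 1)) ⟩
  fromℕ W                                  ∎)
  where open ≤-Reasoning

-- The logarithmic bound

-- 1^a 0^b
onesThenZeros : ℕ → ℕ → Stream
onesThenZeros a b = replicate a true ++ replicate b false

replicate-+ : ∀ m n (b : Bool) → replicate (m ℕ.+ n) b ≡ replicate m b ++ replicate n b
replicate-+ zero    n b = refl
replicate-+ (suc m) n b = cong (b ∷_) (replicate-+ m n b)

count-zeros : ∀ W R → windowCount W (R ++ replicate W false) ≡ 0
count-zeros W R = trans (windowCount-++ W R (replicate W false) (length-replicate W)) (ones-false W)

-- W ones, then enough zeros to go W times round any cycle of length at most W that
-- is entered within W steps.
cycleStream : ℕ → Stream
cycleStream W = onesThenZeros W (W ℕ.+ W ℕ.* W)

module _ {W : ℕ} {ε : ℝ} {A : Algorithm} (ε≤¼ : ε ≤ 4 ⁻¹) (ok : CorrectOn W ε A (cycleStream W)) where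

  private
    configs = Algorithm.configs A

    after : ℕ → Fin configs
    after t = run A (onesThenZeros W t)

    prefix : ∀ {t} → t ℕ.≤ W ℕ.+ W ℕ.* W →
             onesThenZeros W t ++ replicate (W ℕ.+ W ℕ.* W ℕ.∸ t) false ≡ cycleStream W
    prefix {t} t≤ = trans (++-assoc (replicate W true) (replicate t false) _)
      (cong (replicate W true ++_) (trans (sym (replicate-+ t _ false))
        (cong (λ k → replicate k false) (ℕ.m+[n∸m]≡n t≤))))

    after-+ : ∀ {s t} u → after s ≡ after t → after (s ℕ.+ u) ≡ after (t ℕ.+ u)
    after-+ {s} {t} u h = trans (cong (run A) (shift s))
      (trans (run-++ A {onesThenZeros W s} {onesThenZeros W t} (replicate u false) h)
             (cong (run A) (sym (shift t))))
      where
      shift : ∀ s → onesThenZeros W (s ℕ.+ u) ≡ onesThenZeros W s ++ replicate u false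
      shift s = trans (cong (replicate W true ++_) (replicate-+ s u false))
                      (sym (++-assoc (replicate W true) (replicate s false) (replicate u false)))

    after-cycle : ∀ {s p} → after s ≡ after (s ℕ.+ p) → ∀ j → after s ≡ after (s ℕ.+ j ℕ.* p)
    after-cycle {s} {p} h zero    = cong after (sym (ℕ.+-identityʳ s))
    after-cycle {s} {p} h (suc j) = trans h (trans (after-+ p (after-cycle {s} {p} h j))
      (cong after (trans (ℕ.+-assoc s (j ℕ.* p) p) (cong (s ℕ.+_) (ℕ.+-comm (j ℕ.* p) p)))))

    count-early : ∀ {t} → t ℕ.≤ W → windowCount W (onesThenZeros W t) ≡ W ℕ.∸ t
    count-early {t} t≤W = begin
      windowCount W (onesThenZeros W t)
        ≡⟨ cong (λ k → windowCount W (replicate k true ++ replicate t false)) (sym (ℕ.m+[n∸m]≡n t≤W)) ⟩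
      windowCount W (replicate (t ℕ.+ (W ℕ.∸ t)) true ++ replicate t false)
        ≡⟨ cong (λ R → windowCount W (R ++ replicate t false)) (replicate-+ t (W ℕ.∸ t) true) ⟩
      windowCount W ((replicate t true ++ replicate (W ℕ.∸ t) true) ++ replicate t false)
        ≡⟨ cong (windowCount W) (++-assoc (replicate t true) (replicate (W ℕ.∸ t) true) (replicate t false)) ⟩
      windowCount W (replicate t true ++ onesThenZeros (W ℕ.∸ t) t)
        ≡⟨ windowCount-++ W (replicate t true) (onesThenZeros (W ℕ.∸ t) t) len ⟩
      ones (onesThenZeros (W ℕ.∸ t) t)
        ≡⟨ ones-++ (replicate (W ℕ.∸ t) true) (replicate t false) ⟩
      ones (replicate (W ℕ.∸ t) true) ℕ.+ ones (replicate t false)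
        ≡⟨ cong₂ ℕ._+_ (ones-true (W ℕ.∸ t)) (ones-false t) ⟩
      W ℕ.∸ t ℕ.+ 0
        ≡⟨ ℕ.+-identityʳ (W ℕ.∸ t) ⟩
      W ℕ.∸ t ∎
      where
      open ≡-Reasoning
      len : length (onesThenZeros (W ℕ.∸ t) t) ≡ W
      len = trans (length-++ (replicate (W ℕ.∸ t) true))
        (trans (cong₂ ℕ._+_ (length-replicate (W ℕ.∸ t)) (length-replicate t)) (ℕ.m∸n+n≡m t≤W))

    count-late : ∀ {t} → W ℕ.≤ t → windowCount W (onesThenZeros W t) ≡ 0
    count-late {t} W≤t = trans (cong (windowCount W) (begin
      replicate W true ++ replicate t false
        ≡⟨ cong (λ k → replicate W true ++ replicate k false) (sym (ℕ.m∸n+n≡m W≤t)) ⟩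
      replicate W true ++ replicate (t ℕ.∸ W ℕ.+ W) false
        ≡⟨ cong (replicate W true ++_) (replicate-+ (t ℕ.∸ W) W false) ⟩
      replicate W true ++ (replicate (t ℕ.∸ W) false ++ replicate W false)
        ≡⟨ sym (++-assoc (replicate W true) (replicate (t ℕ.∸ W) false) (replicate W false)) ⟩
      onesThenZeros W (t ℕ.∸ W) ++ replicate W false ∎))
      (count-zeros W (onesThenZeros W (t ℕ.∸ W)))
      where open ≡-Reasoning

  -- Assume 2 · configs ≤ W.  The configurations after s and s + p zeros agree for some
  -- s < configs and p > 0, so the one after s zeros recurs after s + Wp ≥ W zeros, when
  -- the window is empty; but after s zeros more than W/2 ones remain in it.
  W<2*configs : W ℕ.< 2 ℕ.* configs
  W<2*configs = ℕ.≰⇒> λ 2n≤W →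
    let i , j , i<j , same = pigeonhole (ℕ.n<1+n configs) (after ∘ toℕ)
        s = toℕ i
        p = toℕ j ℕ.∸ s
        s<n : s ℕ.< configs
        s<n = ℕ.<-≤-trans i<j (ℕ.s≤s⁻¹ (toℕ<n j))
        n≤W : configs ℕ.≤ W
        n≤W = ℕ.≤-trans (ℕ.m≤n*m configs 2) 2n≤W
        s≤W = ℕ.<⇒≤ (ℕ.<-≤-trans s<n n≤W)
        p≤W : p ℕ.≤ W
        p≤W = ℕ.≤-trans (ℕ.m∸n≤m (toℕ j) s) (ℕ.≤-trans (ℕ.s≤s⁻¹ (toℕ<n j)) n≤W)
        t = s ℕ.+ W ℕ.* p
        same′ : after s ≡ after t
        same′ = after-cycle {s} {p} (trans same (cong after (sym (ℕ.m+[n∸m]≡n (ℕ.<⇒≤ i<j))))) W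
        W≤t : W ℕ.≤ t
        W≤t = ℕ.≤-trans (ℕ.m≤m*n W p {{ℕ.>-nonZero (ℕ.m<n⇒0<n∸m i<j)}}) (ℕ.m≤n+m (W ℕ.* p) s)
        s≤W+W*W = ℕ.≤-trans s≤W (ℕ.m≤m+n W (W ℕ.* W))
        t≤ : t ℕ.≤ W ℕ.+ W ℕ.* W
        t≤ = ℕ.+-mono-≤ s≤W (ℕ.*-monoʳ-≤ W p≤W)
        W∸s≤2Wε : fromℕ (W ℕ.∸ s) ≤ fromℕ 2 * (fromℕ W * ε)
        W∸s≤2Wε = same-config⇒close {W} {ε} {A} {R = onesThenZeros W s} {onesThenZeros W t} {g = W ℕ.∸ s}
          ok ok (prefix s≤W+W*W) (prefix t≤) same′
          (trans (count-early s≤W) (sym (trans (cong (W ℕ.∸ s ℕ.+_) (count-late W≤t)) (ℕ.+-identityʳ (W ℕ.∸ s)))))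
    in ℕ.<⇒≱ (few s<n 2n≤W) (m≤2Wε⇒2m≤W {W} ε≤¼ (W ℕ.∸ s) W∸s≤2Wε)
    where
    few : ∀ {s} → s ℕ.< configs → 2 ℕ.* configs ℕ.≤ W → W ℕ.< 2 ℕ.* (W ℕ.∸ s)
    few {s} s<n 2n≤W = subst (W ℕ.<_) (sym (ℕ.*-distribˡ-∸ 2 W s))
      (ℕ.m+n≤o⇒m≤o∸n (suc W) (ℕ.≤-trans
        (ℕ.≤-trans (ℕ.≤-reflexive (sym (ℕ.+-suc W (2 ℕ.* s)))) (ℕ.+-monoʳ-≤ W (ℕ.≤-trans (ℕ.*-monoʳ-< 2 s<n) 2n≤W)))
        (ℕ.≤-reflexive (cong (W ℕ.+_) (sym (ℕ.+-identityʳ W))))))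

  W<2^[1+bits] : W ℕ.< 2 ℕ.^ suc (Algorithm.bits A)
  W<2^[1+bits] = ℕ.<-≤-trans W<2*configs (ℕ.*-monoʳ-≤ 2 (Algorithm.fits A))

-- The block bound

-- The stream of a word: each letter becomes a block of B equal bits.  The first letter
-- arrives last, so that the first differing letter of two words gives the last
-- differing block of their streams.
blocks : ℕ → ∀ {m} → Vec Bool m → Stream
blocks B []      = []
blocks B (a ∷ x) = blocks B x ++ replicate B a

length-blocks : ∀ B {m} (x : Vec Bool m) → length (blocks B x) ≡ m ℕ.* B
length-blocks B []              = refl
length-blocks B {suc m} (a ∷ x) = trans (length-++ (blocks B x))
  (trans (cong₂ ℕ._+_ (length-blocks B x) (length-replicate B)) (ℕ.+-comm (m ℕ.* B) B))

-- Cuts the streams of two different words at their last differing block.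
blocks-split : ∀ B {m} (x y : Vec Bool m) → x ≢ y → ∃[ P ] ∃[ P′ ] ∃[ Q ] ∃[ a ]
  blocks B x ≡ P ++ (replicate B a ++ Q) × blocks B y ≡ P′ ++ (replicate B (not a) ++ Q) ×
  B ℕ.+ length Q ℕ.≤ m ℕ.* B
blocks-split B []      []      x≢y = contradiction refl x≢y
blocks-split B {suc m} (a ∷ x) (b ∷ y) x≢y with b ≟ᵇ a
... | no b≢a = blocks B x , blocks B y , [] , a
  , cong (blocks B x ++_) (sym (++-identityʳ (replicate B a)))
  , cong (blocks B y ++_) (trans (cong (replicate B) (¬-not b≢a)) (sym (++-identityʳ (replicate B (not a)))))
  , ℕ.+-monoʳ-≤ B z≤n
... | yes refl =
  let P , P′ , Q , c , ex , ey , len = blocks-split B x y (x≢y ∘ cong (a ∷_))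
  in P , P′ , Q ++ replicate B a , c
   , trans (cong (_++ replicate B a) ex) (assoc P (replicate B c) Q)
   , trans (cong (_++ replicate B a) ey) (assoc P′ (replicate B (not c)) Q)
   , (begin
        B ℕ.+ length (Q ++ replicate B a)
          ≡⟨ cong (B ℕ.+_) (trans (length-++ Q) (cong (length Q ℕ.+_) (length-replicate B))) ⟩
        B ℕ.+ (length Q ℕ.+ B)                ≡⟨ cong (B ℕ.+_) (ℕ.+-comm (length Q) B) ⟩
        B ℕ.+ (B ℕ.+ length Q)                ≤⟨ ℕ.+-monoʳ-≤ B len ⟩
        suc m ℕ.* B                           ∎)
  where
  open ℕ.≤-Reasoning
  assoc : ∀ P U (Q : Stream) {V} → (P ++ (U ++ Q)) ++ V ≡ P ++ (U ++ (Q ++ V))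
  assoc P U Q {V} = trans (++-assoc P (U ++ Q) V) (cong (P ++_) (++-assoc U Q V))

-- The zeros move the blocks out of the window one bit at a time.
wordStream : ℕ → ℕ → ∀ {m} → Vec Bool m → Stream
wordStream W B x = blocks B x ++ replicate W false

module _ {W : ℕ} {ε : ℝ} {A : Algorithm} {B m : ℕ} (mB≤W : m ℕ.* B ℕ.≤ W)
         (B≰2Wε : ¬ fromℕ B ≤ fromℕ 2 * (fromℕ W * ε)) where

  private
    -- Zeros are appended until the window starts at the differing blocks.
    distinguish : ∀ {x y : Vec Bool m} P P′ Q →
      blocks B x ≡ P ++ (replicate B true ++ Q) → blocks B y ≡ P′ ++ (replicate B false ++ Q) →
      B ℕ.+ length Q ℕ.≤ m ℕ.* B →
      CorrectOn W ε A (wordStream W B x) → CorrectOn W ε A (wordStream W B y) →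
      run A (blocks B x) ≢ run A (blocks B y)
    distinguish {x} {y} P P′ Q ex ey len ok ok′ same = B≰2Wε
      (same-config⇒close {W} {ε} {A} {R = blocks B x ++ replicate z false} {blocks B y ++ replicate z false} {g = B}
        ok ok′ (prefix (blocks B x)) (prefix (blocks B y))
        (run-++ A {blocks B x} {blocks B y} (replicate z false) same)
        (trans (count x true P ex) (trans (cong (ℕ._+ c) (ones-true B))
          (cong (B ℕ.+_) (sym (trans (count y false P′ ey) (cong (ℕ._+ c) (ones-false B))))))))
      where
      b+Q = B ℕ.+ length Q
      z = W ℕ.∸ b+Q
      c = ones (Q ++ replicate z false)
      prefix : ∀ R → (R ++ replicate z false) ++ replicate (W ℕ.∸ z) false ≡ R ++ replicate W false
      prefix R = trans (++-assoc R (replicate z false) (replicate (W ℕ.∸ z) false))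
        (cong (R ++_) (trans (sym (replicate-+ z (W ℕ.∸ z) false))
          (cong (λ k → replicate k false) (ℕ.m+[n∸m]≡n (ℕ.m∸n≤m W b+Q)))))
      count : ∀ (w : Vec Bool m) a P → blocks B w ≡ P ++ (replicate B a ++ Q) →
              windowCount W (blocks B w ++ replicate z false) ≡ ones (replicate B a) ℕ.+ c
      count w a P e = begin
        windowCount W (blocks B w ++ replicate z false)
          ≡⟨ cong (λ R → windowCount W (R ++ replicate z false)) e ⟩
        windowCount W ((P ++ (replicate B a ++ Q)) ++ replicate z false)
          ≡⟨ cong (windowCount W) (trans (++-assoc P (replicate B a ++ Q) (replicate z false))
               (cong (P ++_) (++-assoc (replicate B a) Q (replicate z false)))) ⟩
        windowCount W (P ++ (replicate B a ++ (Q ++ replicate z false)))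
          ≡⟨ windowCount-++ W P _ (begin
               length (replicate B a ++ (Q ++ replicate z false))
                 ≡⟨ trans (length-++ (replicate B a)) (cong₂ ℕ._+_ (length-replicate B) (length-++ Q)) ⟩
               B ℕ.+ (length Q ℕ.+ length (replicate z false))
                 ≡⟨ cong (λ k → B ℕ.+ (length Q ℕ.+ k)) (length-replicate z) ⟩
               B ℕ.+ (length Q ℕ.+ z)
                 ≡⟨ sym (ℕ.+-assoc B (length Q) z) ⟩
               b+Q ℕ.+ z
                 ≡⟨ ℕ.m+[n∸m]≡n (ℕ.≤-trans len mB≤W) ⟩
               W ∎) ⟩
        ones (replicate B a ++ (Q ++ replicate z false))
          ≡⟨ ones-++ (replicate B a) (Q ++ replicate z false) ⟩
        ones (replicate B a) ℕ.+ c ∎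
        where open ≡-Reasoning

  run-blocks-injective : ∀ {x y : Vec Bool m} → x ≢ y →
    CorrectOn W ε A (wordStream W B x) → CorrectOn W ε A (wordStream W B y) →
    run A (blocks B x) ≢ run A (blocks B y)
  run-blocks-injective {x} {y} x≢y ok ok′ with blocks-split B x y x≢y
  ... | P , P′ , Q , true  , ex , ey , len = distinguish {x} {y} P P′ Q ex ey len ok ok′
  ... | P , P′ , Q , false , ex , ey , len = distinguish {y} {x} P′ P Q ey ex len ok′ ok ∘ sym

  correct-words≤2^bits : ∀ xs → Unique xs → All (λ x → CorrectOn W ε A (wordStream W B x)) xs →
                         length xs ℕ.≤ 2 ℕ.^ bits A
  correct-words≤2^bits xs unique ok = ℕ.≤-trans (ℕ.≮⇒≥ λ many →
    let i , j , i<j , same = pigeonhole many (λ i → run A (blocks B (lookup xs i)))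
    in run-blocks-injective (distinct unique i<j) (All.lookup ok (∈-lookup i)) (All.lookup ok (∈-lookup j)) same)
    (Algorithm.fits A)
    where
    distinct : ∀ {xs : List (Vec Bool m)} → Unique xs → ∀ {i j} → i Fin.< j → lookup xs i ≢ lookup xs j
    distinct {_ ∷ xs} (x≢ ∷ _) {Fin.zero}  {Fin.suc j} _   = All.lookup x≢ (∈-lookup j)
    distinct (_ ∷ u)  {Fin.suc i} {Fin.suc j} i<j = distinct u (ℕ.s≤s⁻¹ i<j)

-- All words of length m.
words : ∀ m → List (Vec Bool m)
words zero    = [] ∷ []
words (suc m) = map (false ∷_) (words m) ++ map (true ∷_) (words m)

length-words : ∀ m → length (words m) ≡ 2 ℕ.^ m
length-words zero    = refl
length-words (suc m) = trans (length-++ (map (false ∷_) (words m)))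
  (cong₂ ℕ._+_ (half false) (trans (half true) (sym (ℕ.+-identityʳ (2 ℕ.^ m)))))
  where
  half : ∀ a → length (map (a ∷_) (words m)) ≡ 2 ℕ.^ m
  half a = trans (length-map (a ∷_) (words m)) (length-words m)

words-unique : ∀ m → Unique (words m)
words-unique zero    = [] ∷ []
words-unique (suc m) = AllPairs.++⁺
  (Unique.map⁺ ∷-injectiveʳ (words-unique m)) (Unique.map⁺ ∷-injectiveʳ (words-unique m))
  (All.map⁺ (All.universal (λ x → All.map⁺ (All.universal (λ y → (λ ()) ∘ ∷-injectiveˡ) (words m))) (words m)))

Unique-resp-⊆ : ∀ {X : Set} {xs ys : List X} → xs ⊆ ys → Unique ys → Unique xs
Unique-resp-⊆ []            []      = []
Unique-resp-⊆ (_ ∷ʳ sub)    (_ ∷ u) = Unique-resp-⊆ sub u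
Unique-resp-⊆ (refl ∷ sub)  (x ∷ u) = All-resp-⊆ sub x ∷ Unique-resp-⊆ sub u

-- Expected memory

module MemoryBound (A : RandomizedAlgorithm) where
  open RandomizedAlgorithm A
  open Probability space

  -- The event that at least t bits are used.
  bits≥ : ℕ → Event
  bits≥ zero    = full
  bits≥ (suc t) = ∁ (bits≡ t) ∩ bits≥ t

  ∈bits≥⇒ : ∀ t {ω} → ω ∈ bits≥ t → t ℕ.≤ bits (draw ω)
  ∈bits≥⇒ zero    _ = z≤n
  ∈bits≥⇒ (suc t) {ω} h = ℕ.≤∧≢⇒< (∈bits≥⇒ t (∈∩ʳ h))
    (λ t≡ → to (∈∁ (bits≡ t) ω) (∈∩ˡ h) (from (∈bits≡ t ω) (sym t≡)))

  ∈bits≥⇐ : ∀ t {ω} → t ℕ.≤ bits (draw ω) → ω ∈ bits≥ t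
  ∈bits≥⇐ zero    {ω} _  = ∈full ω
  ∈bits≥⇐ (suc t) {ω} t< = from (∈∩ (∁ (bits≡ t)) (bits≥ t) ω)
    ( from (∈∁ (bits≡ t) ω) (λ h → ℕ.<⇒≢ t< (sym (to (∈bits≡ t ω) h)))
    , ∈bits≥⇐ t (ℕ.<⇒≤ t<))

  -- Markov's inequality.  The event is the disjoint union of its intersections with the
  -- level sets of bits, and the one at level k is empty unless t ≤ k.
  t*P[bits≥t]≤𝔼bits : ∀ t → (fromℕ t * P (bits≥ t)) ≤𝔼bits A
  t*P[bits≥t]≤𝔼bits zero b bound = ≤-trans (≈⇒≤ (λ n → ℚ.*-zeroˡ (seq (P full) n))) (bound 0)
  t*P[bits≥t]≤𝔼bits t@(suc _) b bound = begin
    fromℕ t * P (bits≥ t)            ≲⟨ *-monoˡ-≤ (0≤n/1 t) (proj₂ (P-∪ level (bits≥ t) levels) (t ⁻¹ * b) below) ⟩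
    fromℕ t * (t ⁻¹ * b)             ≈⟨ (λ n → t*[1/t*a] (seq b n)) ⟩
    b                                ∎
    where
    open ≤-Reasoning
    t*[1/t*a] : ∀ a → + t ℚ./ 1 ℚ.* (+ 1 ℚ./ t ℚ.* a) ≡ a
    t*[1/t*a] a = trans (solve 3 (λ t i a → t :* (i :* a) := i :* t :* a) refl (+ t ℚ./ 1) (+ 1 ℚ./ t) a)
      (trans (cong (ℚ._* a) (1/n*n t)) (ℚ.*-identityˡ a))
    level : ℕ → Event
    level k = bits≡ k ∩ bits≥ t
    levels : IsDisjointUnion level (bits≥ t)
    levels = (λ i j i≢j ω (h , k) → i≢j (trans (sym (to (∈bits≡ i ω) (∈∩ˡ h))) (to (∈bits≡ j ω) (∈∩ˡ k))))
           , (λ _ _ → ∈∩ʳ)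
           , (λ ω h none → none (bits (draw ω) , from (∈∩ _ _ ω) (from (∈bits≡ _ ω) refl , h)))
    term : ∀ k → fromℕ t * P (level k) ≤ fromℕ k * P (bits≡ k)
    term k with t ℕ.≤? k
    ... | yes t≤k = begin
      fromℕ t * P (level k)    ≲⟨ *-monoˡ-≤ (0≤n/1 t) (P-mono (λ _ → ∈∩ˡ)) ⟩
      fromℕ t * P (bits≡ k)    ≲⟨ *-monoʳ-≤ {+ t ℚ./ 1} {+ k ℚ./ 1} (P-pos (bits≡ k)) (m/1≤n/1 {t} {k} t≤k) ⟩
      fromℕ k * P (bits≡ k)    ∎
    ... | no t≰k = begin
      fromℕ t * P (level k)    ≲⟨ *-monoˡ-≤ (0≤n/1 t) (P-empty (level k) λ ω h →
                                    t≰k (subst (t ℕ.≤_) (to (∈bits≡ k ω) (∈∩ˡ h)) (∈bits≥⇒ t (∈∩ʳ h)))) ⟩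
      fromℕ t * 0ℝ             ≈⟨ (λ _ → trans (ℚ.*-zeroʳ (+ t ℚ./ 1)) (sym (ℚ.*-zeroʳ (+ k ℚ./ 1)))) ⟩
      fromℕ k * 0ℝ             ≲⟨ *-monoˡ-≤ (0≤n/1 k) (P-pos (bits≡ k)) ⟩
      fromℕ k * P (bits≡ k)    ∎
    t*sums≤ : ∀ n → fromℕ t * partialSums (P ∘ level) n ≤ partialSums (λ k → fromℕ k * P (bits≡ k)) n
    t*sums≤ zero    = ≈⇒≤ (λ _ → ℚ.*-zeroʳ (+ t ℚ./ 1))
    t*sums≤ (suc n) = begin
      fromℕ t * (partialSums (P ∘ level) n + P (level n))
        ≈⟨ (λ k → ℚ.*-distribˡ-+ (+ t ℚ./ 1) (seq (partialSums (P ∘ level) n) k) (seq (P (level n)) k)) ⟩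
      fromℕ t * partialSums (P ∘ level) n + fromℕ t * P (level n)
        ≲⟨ +-mono-≤ (t*sums≤ n) (term n) ⟩
      partialSums (λ k → fromℕ k * P (bits≡ k)) (suc n) ∎
    below : ∀ n → partialSums (P ∘ level) n ≤ t ⁻¹ * b
    below n = *-cancelˡ-≤ {+ t ℚ./ 1} (0<n/1 t) (begin
      fromℕ t * partialSums (P ∘ level) n    ≲⟨ ≤-trans (t*sums≤ n) (bound n) ⟩
      b                                      ≈⟨ (λ n → sym (t*[1/t*a] (seq b n))) ⟩
      fromℕ t * (t ⁻¹ * b)                   ∎)

  t*p≤𝔼bits : ∀ {p} t → fromℚ p ≤ P (bits≥ t) → (fromℕ t * fromℚ p) ≤𝔼bits A
  t*p≤𝔼bits t p≤ b bound = ≤-trans (*-monoˡ-≤ (0≤n/1 t) p≤) (t*P[bits≥t]≤𝔼bits t b bound)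

W<[1+W/B]*B : ∀ W B .{{_ : NonZero B}} → W ℕ.< suc (W ℕ./ B) ℕ.* B
W<[1+W/B]*B W B = subst (ℕ._< suc (W ℕ./ B) ℕ.* B) (sym (m≡m%n+[m/n]*n W B))
  (ℕ.+-monoˡ-< (W ℕ./ B ℕ.* B) (m%n<n W B))

-- Las Vegas algorithms

k[2we]+k≡w[k[2e+i]] : ∀ k w e i → i ℚ.* w ≡ 1ℚ →
  k ℚ.* (+ 2 ℚ./ 1 ℚ.* (w ℚ.* e)) ℚ.+ k ≡ w ℚ.* (k ℚ.* (+ 2 ℚ./ 1 ℚ.* e ℚ.+ i))
k[2we]+k≡w[k[2e+i]] k w e i iw≡1 = trans
  (cong (k ℚ.* (+ 2 ℚ./ 1 ℚ.* (w ℚ.* e)) ℚ.+_) (sym (trans (cong (k ℚ.*_) iw≡1) (ℚ.*-identityʳ k))))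
  (solve 4 (λ k w e i → k :* (con (+ 2 ℚ./ 1) :* (w :* e)) :+ k :* (i :* w)
              := w :* (k :* (con (+ 2 ℚ./ 1) :* e :+ i)))
     refl k w e i)

-- Cutting the window into k blocks makes each longer than 2Wε: the hypothesis on k
-- says 2kWε + k ≤ W, whereas W < (B + 1)k.
k[2ε+W⁻¹]≤1⇒B>2Wε : ∀ W .{{_ : NonZero W}} {ε} k B → W ℕ.< suc B ℕ.* k →
  fromℕ k * (fromℕ 2 * ε + W ⁻¹) ≤ 1ℝ → ¬ fromℕ B ≤ fromℕ 2 * (fromℕ W * ε)
k[2ε+W⁻¹]≤1⇒B>2Wε W {ε} k B W< kx≤1 B≤2Wε = ℕ.<⇒≱ W<
  (fromℕ-cancel-≤ {suc B ℕ.* k} {W} (begin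
    fromℕ (suc B ℕ.* k)
      ≈⟨ (λ _ → [1+B]*k) ⟩
    fromℕ k * fromℕ B + fromℕ k
      ≲⟨ +-monoˡ-≤ (fromℕ k) (*-monoˡ-≤ (0≤n/1 k) B≤2Wε) ⟩
    fromℕ k * (fromℕ 2 * (fromℕ W * ε)) + fromℕ k
      ≈⟨ (λ n → k[2we]+k≡w[k[2e+i]] k′ w (seq ε n) (+ 1 ℚ./ W) (1/n*n W)) ⟩
    fromℕ W * (fromℕ k * (fromℕ 2 * ε + W ⁻¹))
      ≲⟨ W*[kx]≤W*1 ⟩
    fromℕ W * 1ℝ
      ≈⟨ (λ _ → ℚ.*-identityʳ w) ⟩
    fromℕ W ∎))
  where
  open ≤-Reasoning
  w = + W ℚ./ 1
  k′ = + k ℚ./ 1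
  W*[kx]≤W*1 : fromℕ W * (fromℕ k * (fromℕ 2 * ε + W ⁻¹)) ≤ fromℕ W * 1ℝ
  W*[kx]≤W*1 = *-monoˡ-≤ (0≤n/1 W) kx≤1
  [1+B]*k : + (suc B ℕ.* k) ℚ./ 1 ≡ k′ ℚ.* (+ B ℚ./ 1) ℚ.+ k′
  [1+B]*k = trans ([m+n]/1 k (B ℕ.* k)) (trans (cong (k′ ℚ.+_) (trans ([m*n]/1 B k) (ℚ.*-comm (+ B ℚ./ 1) k′)))
    (ℚ.+-comm k′ (k′ ℚ.* (+ B ℚ./ 1))))

-- Here y plays the part of 1 / (2ε + 1/W); only the stated consequence of k ≤ y matters.
k≤bits : ∀ W .{{_ : NonZero W}} {ε} → ε ≤ 4 ⁻¹ → ∀ A → (∀ S → CorrectOn W ε A S) →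
  ∀ y k .{{_ : NonZero k}} → (fromℕ k ≤ y → fromℕ k * (fromℕ 2 * ε + W ⁻¹) ≤ 1ℝ) →
  fromℕ k ≤ log₂ W ⊔ y → k ℕ.≤ bits A
k≤bits W {ε} ε≤¼ A ok y k k≤y⇒ k≤ = ℕ.≮⇒≥ λ bits<k → ℕ.<⇒≱ bits<k (2^-cancel-≤ {k} {bits A} (2^k≤2^bits bits<k))
  where
  B = W ℕ./ k
  module _ (bits<k : bits A ℕ.< k) where
    W<2^k : W ℕ.< 2 ℕ.^ k
    W<2^k = ℕ.<-≤-trans (W<2^[1+bits] {W} {ε} {A} ε≤¼ (ok (cycleStream W))) (ℕ.^-monoʳ-≤ 2 bits<k)
    k≤y : fromℕ k ≤ y
    k≤y = z≤x⊔y∧x<z⇒z≤y {log₂ W} {y} {fromℕ k} k≤ (W<2^k⇒log₂W<k W {k} W<2^k)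
    B≰2Wε : ¬ fromℕ B ≤ fromℕ 2 * (fromℕ W * ε)
    B≰2Wε = k[2ε+W⁻¹]≤1⇒B>2Wε W {ε} k B (W<[1+W/B]*B W k) (k≤y⇒ k≤y)
    2^k≤2^bits : 2 ℕ.^ k ℕ.≤ 2 ℕ.^ bits A
    2^k≤2^bits = subst (ℕ._≤ 2 ℕ.^ bits A) (length-words k)
      (correct-words≤2^bits {W} {ε} {A} {B} {k}
        (subst (ℕ._≤ W) (ℕ.*-comm B k) (m/n*n≤m W k)) B≰2Wε (words k) (words-unique k)
        (All.universal (λ x → ok (wordStream W B x)) (words k)))

module _ {W : ℕ} .{{_ : NonZero W}} {ε : ℝ} (ε≤¼ : ε ≤ 4 ⁻¹)
         (A : RandomizedAlgorithm) (correct : LasVegas W ε A) (y : ℝ) where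
  open RandomizedAlgorithm A
  open Probability space
  open MemoryBound A

  k≤𝔼bits : ∀ k → (fromℕ k ≤ y → fromℕ k * (fromℕ 2 * ε + W ⁻¹) ≤ 1ℝ) →
             fromℕ k ≤ log₂ W ⊔ y → fromℕ k ≤𝔼bits A
  k≤𝔼bits zero      _   _  b bound = bound 0
  k≤𝔼bits k@(suc _) k≤y⇒ k≤ b bound = ≤-trans
    (≈⇒≤ (λ _ → sym (ℚ.*-identityʳ (+ k ℚ./ 1))))
    (t*p≤𝔼bits {1ℚ} k (≤-trans (proj₂ P-full)
      (P-mono (λ ω _ → ∈bits≥⇐ k (k≤bits W ε≤¼ (draw ω) (correct ω) y k k≤y⇒ k≤)))) b bound)

lasVegas : (W : ℕ) .{{_ : NonZero W}} (ε : ℝ) (0≤ε : 0ℝ ≤ ε) → ε ≤ 4 ⁻¹ →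
  (A : RandomizedAlgorithm) → LasVegas W ε A →
  (k : ℕ) → IsFloor (log₂ W ⊔ recip (fromℕ 2 * ε + W ⁻¹) (0<2ε+W⁻¹ W 0≤ε)) k →
  fromℕ k ≤𝔼bits A
lasVegas W {{nz}} ε 0≤ε ε≤¼ A correct k (k≤ , _) = k≤𝔼bits {W} {{nz}} {ε} ε≤¼ A correct
  (recip (fromℕ 2 * ε + (W ⁻¹) {{nz}}) (0<2ε+W⁻¹ W {{nz}} {ε} 0≤ε)) k
  (q≤recip⇒qx≤1 {+ k ℚ./ 1} {fromℕ 2 * ε + (W ⁻¹) {{nz}}} (0<2ε+W⁻¹ W {{nz}} {ε} 0≤ε)) k≤

-- Monte Carlo algorithms

module _ {W : ℕ} {ε δ : ℝ} (A : RandomizedAlgorithm) (correct : MonteCarlo W ε δ A) where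
  open RandomizedAlgorithm A
  open Probability space
  open MemoryBound A

  1-δ≤P[bits≥⌊log₂W⌋] : .{{_ : NonZero W}} → ε ≤ 4 ⁻¹ → 1ℝ - δ ≤ P (bits≥ ⌊log₂ W ⌋)
  1-δ≤P[bits≥⌊log₂W⌋] ε≤¼ =
    let E , E⇒correct , likely = correct (cycleStream W)
    in ≤-trans likely (P-mono λ ω h → ∈bits≥⇐ ⌊log₂ W ⌋ (ℕ.s≤s⁻¹ (2^-cancel-<
         (ℕ.≤-<-trans (2^⌊log₂n⌋≤n W) (W<2^[1+bits] {W} {ε} {draw ω} ε≤¼ (E⇒correct ω h))))))

  -- Among the 2^m equally likely words, a draw with fewer than m bits answers at most
  -- N = 2^(m-1) correctly.
  1-2δ≤P[bits≥m] : ∀ {B} m .{{_ : NonZero m}} → m ℕ.* B ℕ.≤ W → ¬ fromℕ B ≤ fromℕ 2 * (fromℕ W * ε) →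
    1ℝ - fromℕ 2 * δ ≤ P (bits≥ m)
  1-2δ≤P[bits≥m] {B} m@(suc m′) mB≤W B≰2Wε = +-cancelʳ-≤ (fromℕ 2 * δ) (begin
    1ℝ - fromℕ 2 * δ + fromℕ 2 * δ
      ≈⟨ (λ n → solve 1 (λ d → con 1ℚ :- d :+ d := con 1ℚ) refl (seq (fromℕ 2 * δ) n)) ⟩
    1ℝ
      ≲⟨ 1≤P[E]+P[∁E] (bits≥ m) ⟩
    P (bits≥ m) + P F
      ≲⟨ +-monoʳ-≤ (P (bits≥ m)) (*-cancelˡ-≤ {+ N ℚ./ 1} (0<n/1 N {{ℕ.m^n≢0 2 m′}}) N*P≤N*2δ) ⟩
    P (bits≥ m) + fromℕ 2 * δ ∎)
    where
    open ≤-Reasoning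
    N = 2 ℕ.^ m′
    F = ∁ (bits≥ m)
    E : Vec Bool m → Event
    E x = proj₁ (correct (wordStream W B x))
    few : AtMost E N (words m) F
    few xs xs⊆ len ω h all = ℕ.<⇒≱ (subst (ℕ._≤ 2 ℕ.^ bits (draw ω)) len
        (correct-words≤2^bits {W} {ε} {draw ω} {B} {m} mB≤W B≰2Wε xs (Unique-resp-⊆ xs⊆ (words-unique m))
          (All.map (λ {x} → proj₁ (proj₂ (correct (wordStream W B x))) ω) all)))
      (ℕ.^-monoʳ-≤ 2 (ℕ.s≤s⁻¹ (ℕ.≰⇒> λ m≤ → to (∈∁ (bits≥ m) ω) h (∈bits≥⇐ m m≤))))
    2N : + length (words m) ℚ./ 1 ≡ + 2 ℚ./ 1 ℚ.* (+ N ℚ./ 1)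
    2N = trans (cong (λ k → + k ℚ./ 1) (length-words m)) ([m*n]/1 2 N)
    N*P≤N*2δ : fromℕ N * P F ≤ fromℕ N * (fromℕ 2 * δ)
    N*P≤N*2δ = +-cancelʳ-≤ (fromℕ N * P F) (begin
      fromℕ N * P F + fromℕ N * P F
        ≈⟨ (λ n → trans (solve 2 (λ m p → m :* p :+ m :* p := con (+ 2 ℚ./ 1) :* m :* p) refl (+ N ℚ./ 1) (seq (P F) n))
                        (cong (ℚ._* seq (P F) n) (sym 2N))) ⟩
      fromℕ (length (words m)) * P F
        ≲⟨ N*P[F]≤ΣP+N*δ E (words m) F (λ x → proj₂ (proj₂ (correct (wordStream W B x)))) ⟩
      ΣP E (words m) F + fromℕ (length (words m)) * δ
        ≲⟨ +-monoˡ-≤ (fromℕ (length (words m)) * δ) (ΣP≤M*P[F] E N (words m) F few) ⟩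
      fromℕ N * P F + fromℕ (length (words m)) * δ
        ≈⟨ (λ n → trans (cong (λ u → + N ℚ./ 1 ℚ.* seq (P F) n ℚ.+ u ℚ.* seq δ n) 2N)
             (solve 3 (λ m p d → m :* p :+ con (+ 2 ℚ./ 1) :* m :* d := m :* (con (+ 2 ℚ./ 1) :* d) :+ m :* p)
               refl (+ N ℚ./ 1) (seq (P F) n) (seq δ n))) ⟩
      fromℕ N * (fromℕ 2 * δ) + fromℕ N * P F ∎)

2≤W∧2n≤W⇒n<W : ∀ {W} → 2 ℕ.≤ W → ∀ n → 2 ℕ.* n ℕ.≤ W → n ℕ.< W
2≤W∧2n≤W⇒n<W 2≤W zero      _    = ℕ.<⇒≤ 2≤W
2≤W∧2n≤W⇒n<W 2≤W n@(suc _) 2n≤W = ℕ.<-≤-trans (ℕ.m<m+n n (s≤s z≤n)) 2n≤W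

-- The floor of x is not computable, but a nonnegative x that is not above some n
-- cannot fail to have one.
¬¬floor : ∀ {x} → 0ℝ ≤ x → ∀ n → ¬ fromℕ n ≤ x →
          ¬ ¬ (∃[ k ] fromℕ k ≤ x × ¬ fromℕ (suc k) ≤ x)
¬¬floor 0≤x zero    n≰x _    = n≰x 0≤x
¬¬floor 0≤x (suc n) n≰x none = ¬¬floor 0≤x n (λ n≤x → none (n , n≤x , n≰x)) none

-- d is a rational lower bound for 1/2 - δ.
module _ {δ : ℝ} (d : ℚ) (0<d : 0ℚ ℚ.< d) (0≤δ : 0ℝ ≤ δ) (δ+d≤½ : δ + fromℚ d ≤ 2 ⁻¹) where

  private
    2d : ℚ
    2d = + 2 ℚ./ 1 ℚ.* d

    2d≤1-2δ : fromℚ 2d ≤ 1ℝ - fromℕ 2 * δ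
    2d≤1-2δ = begin
      fromℚ 2d
        ≈⟨ (λ n → solve 2 (λ d δ → con (+ 2 ℚ./ 1) :* d
              := con (+ 2 ℚ./ 1) :* (δ :+ d) :+ :- (con (+ 2 ℚ./ 1) :* δ))
                                                            refl d (seq δ n)) ⟩
      fromℕ 2 * (δ + fromℚ d) - fromℕ 2 * δ            ≲⟨ +-monoˡ-≤ (- (fromℕ 2 * δ)) (*-monoˡ-≤ (0≤n/1 2) δ+d≤½) ⟩
      fromℕ 2 * 2 ⁻¹ - fromℕ 2 * δ                     ≈⟨ (λ _ → refl) ⟩
      1ℝ - fromℕ 2 * δ                                 ∎
      where open ≤-Reasoning

    1-2δ≤1-δ : 1ℝ - fromℕ 2 * δ ≤ 1ℝ - δ
    1-2δ≤1-δ = begin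
      1ℝ - fromℕ 2 * δ
        ≈⟨ (λ n → solve 1 (λ δ → con 1ℚ :- con (+ 2 ℚ./ 1) :* δ
              := con 1ℚ :- con (+ 2 ℚ./ 1) :* δ :+ con 0ℚ) refl (seq δ n)) ⟩
      1ℝ - fromℕ 2 * δ + 0ℝ          ≲⟨ +-monoʳ-≤ (1ℝ - fromℕ 2 * δ) 0≤δ ⟩
      1ℝ - fromℕ 2 * δ + δ
        ≈⟨ (λ n → solve 1 (λ δ → con 1ℚ :- con (+ 2 ℚ./ 1) :* δ :+ δ := con 1ℚ :- δ) refl (seq δ n)) ⟩
      1ℝ - δ                         ∎
      where open ≤-Reasoning

  -- Each of t = m and t = ⌊log₂ W⌋ gives the bound 2dt, as 2d ≤ 1 - 2δ.  Their average is
  -- d(m + ⌊log₂ W⌋), where m is the number of blocks, 1/ε ≤ 8m and log₂ W ≤ 8⌊log₂ W⌋.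
  c : ℝ
  c = fromℚ (+ 1 ℚ./ 8 ℚ.* d)

  0<c : 0ℝ < c
  0<c = mk< (+ 1 ℚ./ 8 ℚ.* d) 0<d/8 (0 , λ _ _ → ℚ.≤-reflexive (ℚ.+-identityˡ _))
    where
    0<d/8 : 0ℚ ℚ.< + 1 ℚ./ 8 ℚ.* d
    0<d/8 = 0<p*q (0<1/n 8) 0<d

  -- Here y plays the part of 1 / ε.
  c[y+log₂W]≤𝔼bits : ∀ {W} .{{_ : NonZero W}} → 2 ℕ.≤ W → ∀ {ε} → 2 ⁻¹ * W ⁻¹ ≤ ε → ε ≤ 4 ⁻¹ →
    ∀ A → MonteCarlo W ε δ A → ∀ y → (∀ q → 1ℝ ≤ fromℚ q * ε → y ≤ fromℚ q) →
    c * (y + log₂ W) ≤𝔼bits A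
  c[y+log₂W]≤𝔼bits {W} 2≤W {ε} ε≥1/2W ε≤¼ A correct y y≤ b bound = ≮⇒≥ λ b< →
    ¬¬floor 0≤2Wε (suc W) (λ h → ℕ.<⇒≱ (ℕ.m≤n*m (suc W) 2) (m≤2Wε⇒2m≤W {W} ε≤¼ (suc W) h))
      λ (B′ , B′≤2Wε , B≰2Wε) → <⇒≱ b< (main B′ B′≤2Wε B≰2Wε)
    where
    open ≤-Reasoning
    open MemoryBound A
    l = ⌊log₂ W ⌋
    w = + W ℚ./ 1
    2Wε = fromℕ 2 * (fromℕ W * ε)

    1≤2Wε : 1ℝ ≤ 2Wε
    1≤2Wε = begin
      1ℝ
        ≈⟨ (λ _ → sym (trans (solve 2 (λ w i → con (+ 2 ℚ./ 1) :* (w :* (con ½ :* i)) := i :* w)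
                                                     refl w (+ 1 ℚ./ W)) (1/n*n W))) ⟩
      fromℕ 2 * (fromℕ W * (2 ⁻¹ * W ⁻¹))       ≲⟨ *-monoˡ-≤ (0≤n/1 2) (*-monoˡ-≤ (0≤n/1 W) ε≥1/2W) ⟩
      2Wε                                       ∎

    0≤2Wε : 0ℝ ≤ 2Wε
    0≤2Wε = ≤-trans (fromℕ-mono-≤ {0} {1} z≤n) 1≤2Wε

    log₂W≤8l : log₂ W ≤ fromℕ (8 ℕ.* l)
    log₂W≤8l = begin
      log₂ W            ≲⟨ log₂W≤1+⌊log₂W⌋ W ⟩
      fromℕ l + 1ℝ      ≈⟨ (λ _ → sym ([m+n]/1 l 1)) ⟩
      fromℕ (l ℕ.+ 1)   ≲⟨ fromℕ-mono-≤ {l ℕ.+ 1} {8 ℕ.* l} (ℕ.+-monoʳ-≤ l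
                             (ℕ.≤-trans (⌊log₂⌋-mono-≤ 2≤W) (ℕ.m≤m+n l (6 ℕ.* l)))) ⟩
      fromℕ (8 ℕ.* l)   ∎

    -- B = B′ + 1 is the least integer that is not at most 2Wε, so B ≤ 2Wε + 1 ≤ 4Wε.
    module _ (B′ : ℕ) (B′≤2Wε : fromℕ B′ ≤ 2Wε) (B≰2Wε : ¬ fromℕ (suc B′) ≤ 2Wε) where
      B = suc B′
      m = W ℕ./ B

      B≤W : B ℕ.≤ W
      B≤W = 2≤W∧2n≤W⇒n<W 2≤W B′ (m≤2Wε⇒2m≤W {W} ε≤¼ B′ B′≤2Wε)

      instance
        m≢0 : NonZero m
        m≢0 = ℕ.>-nonZero (m≥n⇒m/n>0 B≤W)

      W≤2m*B : W ℕ.≤ 2 ℕ.* m ℕ.* B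
      W≤2m*B = ℕ.≤-trans (ℕ.<⇒≤ (W<[1+W/B]*B W B)) (ℕ.*-monoˡ-≤ B
        (ℕ.≤-trans (ℕ.+-monoˡ-≤ m (ℕ.>-nonZero⁻¹ m)) (ℕ.≤-reflexive (cong (m ℕ.+_) (sym (ℕ.+-identityʳ m))))))

      1≤8mε : 1ℝ ≤ fromℕ (8 ℕ.* m) * ε
      1≤8mε = *-cancelˡ-≤ {w} (0<n/1 W) (begin
        fromℕ W * 1ℝ                             ≈⟨ (λ _ → ℚ.*-identityʳ w) ⟩
        fromℕ W                                  ≲⟨ fromℕ-mono-≤ W≤2m*B ⟩
        fromℕ (2 ℕ.* m ℕ.* B)
          ≈⟨ (λ _ → trans ([m*n]/1 (2 ℕ.* m) B) (cong (+ (2 ℕ.* m) ℚ./ 1 ℚ.*_) ([m+n]/1 1 B′))) ⟩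
        fromℕ (2 ℕ.* m) * (1ℝ + fromℕ B′)        ≲⟨ *-monoˡ-≤ (0≤n/1 (2 ℕ.* m)) (+-mono-≤ 1≤2Wε B′≤2Wε) ⟩
        fromℕ (2 ℕ.* m) * (2Wε + 2Wε)            ≈⟨ (λ n → trans (cong (ℚ._* (seq 2Wε n ℚ.+ seq 2Wε n)) ([m*n]/1 2 m))
                                                      (trans (solve 3 (λ m w e → con (+ 2 ℚ./ 1) :* m
                                                          :* (con (+ 2 ℚ./ 1) :* (w :* e) :+ con (+ 2 ℚ./ 1) :* (w :* e))
                                                        := w :* (con (+ 8 ℚ./ 1) :* m :* e)) refl (+ m ℚ./ 1) w (seq ε n))
                                                      (cong (λ u → w ℚ.* (u ℚ.* seq ε n)) (sym ([m*n]/1 8 m))))) ⟩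
        fromℕ W * (fromℕ (8 ℕ.* m) * ε)          ∎)

      main : c * (y + log₂ W) ≤ b
      main = begin
        c * (y + log₂ W)
          ≲⟨ *-monoˡ-≤ 0≤d/8 (+-mono-≤ (y≤ (+ (8 ℕ.* m) ℚ./ 1) 1≤8mε) log₂W≤8l) ⟩
        c * (fromℕ (8 ℕ.* m) + fromℕ (8 ℕ.* l))
          ≈⟨ (λ _ → trans (cong₂ (λ u v → + 1 ℚ./ 8 ℚ.* d ℚ.* (u ℚ.+ v)) ([m*n]/1 8 m) ([m*n]/1 8 l))
               (solve 3 (λ d m l → con (+ 1 ℚ./ 8) :* d :* (con (+ 8 ℚ./ 1) :* m :+ con (+ 8 ℚ./ 1) :* l)
                  := con ½ :* (m :* (con (+ 2 ℚ./ 1) :* d)) :+ con ½ :* (l :* (con (+ 2 ℚ./ 1) :* d)))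
                  refl d (+ m ℚ./ 1) (+ l ℚ./ 1))) ⟩
        2 ⁻¹ * (fromℕ m * fromℚ 2d) + 2 ⁻¹ * (fromℕ l * fromℚ 2d)
          ≲⟨ +-mono-≤ (*-monoˡ-≤ (ℚ.<⇒≤ 0<½) (t*p≤𝔼bits {2d} m
                          (≤-trans 2d≤1-2δ (1-2δ≤P[bits≥m] {W} {ε} {δ} A correct {B} m (m/n*n≤m W B) B≰2Wε)) b bound))
                      (*-monoˡ-≤ (ℚ.<⇒≤ 0<½) (t*p≤𝔼bits {2d} l
                          (≤-trans 2d≤1-2δ (≤-trans 1-2δ≤1-δ (1-δ≤P[bits≥⌊log₂W⌋] {W} {ε} {δ} A correct ε≤¼))) b bound)) ⟩
        2 ⁻¹ * b + 2 ⁻¹ * b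
          ≈⟨ (λ n → η≡½η+½η (seq b n)) ⟩
        b ∎
        where
        0≤d/8 : 0ℚ ℚ.≤ + 1 ℚ./ 8 ℚ.* d
        0≤d/8 = ℚ.<⇒≤ (0<p*q (0<1/n 8) 0<d)

theorem6 : ( (W : ℕ) .{{_ : NonZero W}} (ε : ℝ) (0≤ε : 0ℝ ≤ ε) → ε ≤ 4 ⁻¹ →
    (A : RandomizedAlgorithm) → LasVegas W ε A →
    (k : ℕ) → IsFloor (log₂ W ⊔ recip (fromℕ 2 * ε + W ⁻¹) (0<2ε+W⁻¹ W 0≤ε)) k →
    fromℕ k ≤𝔼bits A )
    ×
    ( (δ : ℝ) → 0ℝ < δ → δ < 2 ⁻¹ →
    ∃[ c ] 0ℝ < c × ∃[ W₀ ]
    ((W : ℕ) .{{_ : NonZero W}} → W₀ ℕ.≤ W →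
    (ε : ℝ) (ε≥1/2W : 2 ⁻¹ * W ⁻¹ ≤ ε) → ε ≤ 4 ⁻¹ →
    (A : RandomizedAlgorithm) → MonteCarlo W ε δ A →
    c * (recip ε (<-≤-trans (0<2⁻¹*W⁻¹ W) ε≥1/2W) + log₂ W) ≤𝔼bits A) )
theorem6 = lasVegas , λ δ 0<δ (mk< d 0<d (N , δ+d≤½)) →
  let 0≤δ = <⇒≤ 0<δ
      δ+d≤½′ : δ + fromℚ d ≤ 2 ⁻¹
      δ+d≤½′ = mk≤ λ η 0<η → N , λ n n≥ → ℚ.≤-trans (δ+d≤½ n n≥) (p≤p+η (+ 1 ℚ./ 2) (ℚ.<⇒≤ 0<η))
  in c d 0<d 0≤δ δ+d≤½′ , 0<c d 0<d 0≤δ δ+d≤½′ , 2 , λ W {{nz}} 2≤W ε ε≥1/2W ε≤¼ A correct →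
     let 0<ε = <-≤-trans (0<2⁻¹*W⁻¹ W {{nz}}) ε≥1/2W in
     c[y+log₂W]≤𝔼bits d 0<d 0≤δ δ+d≤½′ {W} {{nz}} 2≤W {ε} ε≥1/2W ε≤¼ A correct
       (recip ε 0<ε) (λ q → 1≤qx⇒recip≤q {q} {ε} 0<ε)
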